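{- Let $\alpha\geq 1$ and $C>0$ be real numbers. For every triple of positive integers $k,\ell,r$ with $k\geq 3$ and $r\geq 3$, there exists a positive integer $N$ (depending on $k,\ell,r$ and on the constants $C,\alpha$) such that for all positive integers $n_1\leq n_2\leq\cdots\leq n_r$ with $n_r\leq C n_1^{\alpha}$ and $n_1\geq N$: (i) if $k<r$, then $rx_{k,\ell}(K_{n_1,n_2,\dots,n_r})=k$; (ii) if $k\geq r$ and $\ell\leq \dfrac{\binom{r}{2}\lceil k/r\rceil^{2}}{\lfloor k/r\rfloor}$, then $rx_{k,\ell}(K_{n_1,n_2,\dots,n_r})\in\{k,k+1\}$; (iii) if $k\geq r$ and $\ell> \dfrac{\binom{r}{2}\lceil k/r\rceil^{2}}{\lfloor k/r\rfloor}$, then $rx_{k,\ell}(K_{n_1,n_2,\dots,n_r})=k+1$. Moreover, when $k=r=3$ and $\ell\leq 3$ (where $3=\binom{r}{2}\lceil k/r\rceil^{2}/\lfloor k/r\rfloor$), there exists a positive integer $N$ (depending on $\ell$ and on $C,\alpha$) such that $rx_{3,\ell}(K_{n_1,n_2,n_3})=3$ for all positive integers $n_1\leq n_2\leq n_3$ with $n_3\leq C n_1^{\alpha}$ and $n_1\geq N$.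
   Context: All graphs are undirected, finite and simple. $K_{n_1,\dots,n_r}$ is the complete multipartite graph with $r$ vertex classes of sizes $n_1,\dots,n_r$. An edge-coloring of a graph $G$ with $t$ colors is any map $c:E(G)\to\{1,\dots,t\}$ (adjacent edges may receive the same color). A tree $T$ that is a subgraph of $G$ is a rainbow tree if no two edges of $T$ have the same color. For $S\subseteq V(G)$, an $S$-tree is a tree in $G$ containing all vertices of $S$, and a rainbow $S$-tree is an $S$-tree that is a rainbow tree. Rainbow $S$-trees $T_1,\dots,T_\ell$ are internally disjoint if $E(T_i)\cap E(T_j)=\emptyset$ and $V(T_i)\cap V(T_j)=S$ for all $1\le i,j\le \ell$ with $i\neq j$. The $(k,\ell)$-rainbow index $rx_{k,\ell}(G)$, defined for positive integers $k,\ell$, is the minimum number of colors needed in an edge-coloring of $G$ such that for every set $S$ of $k$ vertices of $G$ there exist $\ell$ internally disjoint rainbow $S$-trees. -}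

module Defs where

open import Data.Fin.Base as Fin using (Fin; splitAt)
import Data.Fin.Properties as Fin
open import Data.Fin.Subset using (Subset; _∈_; _⊆_; _∩_; ∣_∣; Nonempty)
open import Data.Integer.Base as ℤ using (+_)
open import Data.List.Base using (List; _∷_; _∷ʳ_; length)
open import Data.List.Relation.Unary.Linked using (Linked)
open import Data.List.Relation.Unary.Unique.Propositional using (Unique)
open import Data.Nat.Base as ℕ using (ℕ; suc; _+_; _*_; _^_; _≤_; NonZero; pred)
open import Data.Nat.Combinatorics using () renaming (_C_ to _choose_)
open import Data.Nat.DivMod using (_/_; m≥n⇒m/n>0)
open import Data.Product.Base using (Σ-syntax; ∃-syntax; _×_; _,_)
open import Data.Rational.Base as ℚ using (ℚ; ↥_; ↧ₙ_; 0ℚ; 1ℚ)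
import Data.Rational.Properties as ℚ
open import Data.Sum.Base using (_⊎_; inj₁; inj₂; [_,_]′)
open import Data.Vec.Base using (Vec; _∷_; sum; lookup)
open import Function.Base using (_∘_; const)
open import Level using (0ℓ)
open import Relation.Binary.Construct.Closure.ReflexiveTransitive using (Star)
open import Relation.Binary.Core using (Rel)
open import Relation.Binary.Definitions using (Symmetric; Irreflexive; Decidable; tri<; tri≈; tri>)
open import Relation.Binary.PropositionalEquality using (_≡_; _≢_; refl; sym)
open import Relation.Nullary using (¬_; ¬?)

-- Two-sided Dedekind cuts of ℚ.

record ℝ : Set₁ where
  field
    Lower Upper     : ℚ → Set
    lower-inhabited : ∃[ q ] Lower q
    upper-inhabited : ∃[ q ] Upper q
    lower-closed    : ∀ {p q} → p ℚ.< q → Lower q → Lower p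
    upper-closed    : ∀ {p q} → p ℚ.< q → Upper p → Upper q
    lower-open      : ∀ {p} → Lower p → ∃[ q ] (p ℚ.< q × Lower q)
    upper-open      : ∀ {q} → Upper q → ∃[ p ] (p ℚ.< q × Upper p)
    disjoint        : ∀ {q} → Lower q → ¬ Upper q
    located         : ∀ {p q} → p ℚ.< q → Lower p ⊎ Upper q

open ℝ public using (Lower; Upper)

infix 4 _<ᴿ_ _≤ᴿ_

_<ᴿ_ : ℝ → ℝ → Set
x <ᴿ y = ∃[ q ] (Upper x q × Lower y q)

_≤ᴿ_ : ℝ → ℝ → Set
x ≤ᴿ y = ∀ {q} → Lower x q → Lower y q

fromℚ : ℚ → ℝ
fromℚ x = record
  { Lower           = ℚ._< x
  ; Upper           = x ℚ.<_
  ; lower-inhabited = x ℚ.- 1ℚ , below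
  ; upper-inhabited = x ℚ.+ 1ℚ , above
  ; lower-closed    = ℚ.<-trans
  ; upper-closed    = λ p<q x<p → ℚ.<-trans x<p p<q
  ; lower-open      = λ p<x → let q , p<q , q<x = ℚ.<-dense p<x in q , p<q , q<x
  ; upper-open      = λ x<q → let p , x<p , p<q = ℚ.<-dense x<q in p , p<q , x<p
  ; disjoint        = ℚ.<-asym
  ; located         = loc
  }
  where
  respʳ : ∀ {p q q′} → q ≡ q′ → p ℚ.< q → p ℚ.< q′
  respʳ refl p<q = p<q

  respˡ : ∀ {p p′ q} → p ≡ p′ → p ℚ.< q → p′ ℚ.< q
  respˡ refl p<q = p<q

  below : x ℚ.- 1ℚ ℚ.< x
  below = respʳ (ℚ.+-identityʳ x) (ℚ.+-monoʳ-< x (ℚ.negative⁻¹ (ℚ.- 1ℚ)))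

  above : x ℚ.< x ℚ.+ 1ℚ
  above = respˡ (ℚ.+-identityʳ x) (ℚ.+-monoʳ-< x (ℚ.positive⁻¹ 1ℚ))

  loc : ∀ {p q} → p ℚ.< q → p ℚ.< x ⊎ x ℚ.< q
  loc {p} p<q with ℚ.<-cmp p x
  ... | tri< p<x _ _    = inj₁ p<x
  ... | tri≈ _ refl _   = inj₂ p<q
  ... | tri> _ _    x<p = inj₂ (ℚ.<-trans x<p p<q)

0ℝ 1ℝ : ℝ
0ℝ = fromℚ 0ℚ
1ℝ = fromℚ 1ℚ

-- m ≤ C · n ^ α for natural numbers m, n and reals C, α > 0 (it is not
-- meaningful for other C, α).  Since n is a natural number, C · n ^ α is the
-- infimum of c · n ^ q over the rationals c > C and q > α.  Writing c = a / b
-- and q = u / v, the inequality m ≤ c · n ^ q is (m b) ^ v ≤ a ^ v · n ^ u.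

infix 4 _≤_·_^ᴿ_

_≤_·_^ᴿ_ : ℕ → ℝ → ℕ → ℝ → Set
m ≤ C · n ^ᴿ α = ∀ {c q} → Upper C c → Upper α q →
  (m * ↧ₙ c) ^ (↧ₙ q) ≤ ℤ.∣ ↥ c ∣ ^ (↧ₙ q) * n ^ ℤ.∣ ↥ q ∣

record Graph (n : ℕ) : Set₁ where
  infix 4 _∼_
  field
    _∼_      : Rel (Fin n) 0ℓ
    ∼-dec    : Decidable _∼_
    ∼-sym    : Symmetric _∼_
    ∼-irrefl : Irreflexive _≡_ _∼_

-- The edges of a subgraph are given by the neighbourhoods of its vertices.

record Subgraph {n} (G : Graph n) : Set where
  open Graph G
  field
    vertices      : Subset n
    neighbours    : Fin n → Subset n
    neighbour-sym : ∀ {u v} → v ∈ neighbours u → u ∈ neighbours v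
    edge⇒vertex   : ∀ {u v} → v ∈ neighbours u → u ∈ vertices
    edge⇒∼        : ∀ {u v} → v ∈ neighbours u → u ∼ v

  Edge : Rel (Fin n) 0ℓ
  Edge u v = v ∈ neighbours u

module _ {n} {G : Graph n} where

  open Subgraph

  Connected : Subgraph G → Set
  Connected T = Nonempty (vertices T) ×
    (∀ {u v} → u ∈ vertices T → v ∈ vertices T → Star (Edge T) u v)

  -- The cycle v, v₁, …, vₘ, v, where v, v₁, …, vₘ are distinct and m ≥ 2.

  IsCycle : Subgraph G → Fin n → List (Fin n) → Set
  IsCycle T v vs =
    2 ≤ length vs × Unique (v ∷ vs) × Linked (Edge T) (v ∷ (vs ∷ʳ v))

  Acyclic : Subgraph G → Set
  Acyclic T = ∀ v vs → ¬ IsCycle T v vs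

  IsTree : Subgraph G → Set
  IsTree T = Connected T × Acyclic T

-- A colour is assigned to each edge, not to a proof of adjacency: the proof
-- argument is irrelevant.

record EdgeColouring {n} (G : Graph n) (t : ℕ) : Set where
  open Graph G
  field
    colour     : ∀ u v → .(u ∼ v) → Fin t
    colour-sym : ∀ u v → .(e : u ∼ v) → colour u v e ≡ colour v u (∼-sym e)

module _ {n} {G : Graph n} where

  open Subgraph

  Rainbow : ∀ {t} → EdgeColouring G t → Subgraph G → Set
  Rainbow c T = ∀ {u v x y} (e : Edge T u v) (f : Edge T x y) →
    colour u v (edge⇒∼ T e) ≡ colour x y (edge⇒∼ T f) →
    (u ≡ x × v ≡ y) ⊎ (u ≡ y × v ≡ x)
    where open EdgeColouring c

  IsRainbowSTree : ∀ {t} → EdgeColouring G t → Subset n → Subgraph G → Set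
  IsRainbowSTree c S T = IsTree T × S ⊆ vertices T × Rainbow c T

  InternallyDisjoint : ∀ {ℓ} → Subset n → (Fin ℓ → Subgraph G) → Set
  InternallyDisjoint S T = ∀ {i j} → i ≢ j →
    (∀ u v → Edge (T i) u v → ¬ Edge (T j) u v) ×
    vertices (T i) ∩ vertices (T j) ≡ S

RainbowColourable : ∀ {n} → ℕ → ℕ → Graph n → ℕ → Set
RainbowColourable {n} k ℓ G t =
  Σ[ c ∈ EdgeColouring G t ] ∀ (S : Subset n) → ∣ S ∣ ≡ k →
    Σ[ T ∈ (Fin ℓ → Subgraph G) ]
      ((∀ i → IsRainbowSTree c S (T i)) × InternallyDisjoint S T)

-- rx k , ℓ ⟨ G ⟩≔ t says that the (k,ℓ)-rainbow index of G exists and equals t.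

infix 4 rx_,_⟨_⟩≔_

rx_,_⟨_⟩≔_ : ∀ {n} → ℕ → ℕ → Graph n → ℕ → Set
rx k , ℓ ⟨ G ⟩≔ t =
  RainbowColourable k ℓ G t × (∀ s → RainbowColourable k ℓ G s → t ≤ s)

-- The vertex set Fin (n₁ + ⋯ + nᵣ) is cut into consecutive blocks of sizes
-- n₁, …, nᵣ.

class : ∀ {r} (ns : Vec ℕ r) → Fin (sum ns) → Fin r
class (n ∷ ns) v = [ const Fin.zero , Fin.suc ∘ class ns ]′ (splitAt n v)

K : ∀ {r} (ns : Vec ℕ r) → Graph (sum ns)
K ns = record
  { _∼_      = λ u v → class ns u ≢ class ns v
  ; ∼-dec    = λ u v → ¬? (class ns u Fin.≟ class ns v)
  ; ∼-sym    = λ u≁v eq → u≁v (sym eq)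
  ; ∼-irrefl = λ { refl u≢u → u≢u refl }
  }

first last : ∀ {r} .{{_ : NonZero r}} → Vec ℕ r → ℕ
first {suc r} ns = lookup ns Fin.zero
last  {suc r} ns = lookup ns (Fin.fromℕ r)

record Admissible (C α : ℝ) (N : ℕ) {r} .{{_ : NonZero r}} (ns : Vec ℕ r) : Set where
  field
    positive  : ∀ i → 1 ≤ lookup ns i
    monotone  : ∀ {i j} → i Fin.≤ j → lookup ns i ≤ lookup ns j
    growth    : last ns ≤ C · first ns ^ᴿ α
    large     : N ≤ first ns

⌈_/_⌉ : (k r : ℕ) .{{_ : NonZero r}} → ℕ
⌈ k / r ⌉ = (k + pred r) / r

-- binom(r,2) ⌈k/r⌉² / ⌊k/r⌋, where r ≤ k makes the denominator nonzero.

threshold : (k r : ℕ) .{{_ : NonZero r}} → r ≤ k → ℚ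
threshold k r r≤k =
  (+ ((r choose 2) * ⌈ k / r ⌉ ^ 2) ℚ./ (k / r)) {{ℕ.>-nonZero (m≥n⇒m/n>0 r≤k)}}

fromℕ : ℕ → ℚ
fromℕ n = + n ℚ./ 1

{-# OPTIONS --safe #-}
-- Only the edges of one vertex to a given set are ever prescribed.  There is an
-- explicit colouring of K in which, for any few vertices and any colours for
-- them, every class contains a further vertex joined to them in these colours
-- (Extendable below); vertices are named by boundedly many letters from an
-- alphabet so small that all the required decision lists fit into one class,
-- and this is where n_r ≤ C n₁ ^ α enters.  If k < r, such a vertex in a class
-- missed by S is the centre of a rainbow star on S with k colours.  In general
-- two adjacent centres in different classes, added to S, carry a rainbow double
-- star with k + 1 colours.  If k = r = 3 and S meets all classes, one edge inside
-- S extends to a rainbow path through one further vertex, and S has three edges.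
-- For the lower bounds, a rainbow tree with t colours has at most t + 1
-- vertices; a set S inside one class forces k colours, and for a balanced S with
-- k colours every tree uses at least ⌊k/r⌋ of the edges inside S.
module Submission where

open import Defs
open import Data.Bool.Base using (Bool; true; false; if_then_else_)
import Data.Bool.Properties as Bool
open import Data.Empty using (⊥)
open import Data.Fin.Base as Fin using (Fin; zero; suc; toℕ)
import Data.Fin.Properties as Fin
open import Data.Fin.Subset using (Subset; inside; outside; _∈_; _∉_; _⊆_; _⊃_; _∪_; _∩_; ⁅_⁆; ∣_∣) renaming (⊥ to ∅)
import Data.Fin.Subset.Properties as Subset
open import Data.Fin.Subset.Induction using (⊃-wellFounded; Acc; acc)
import Data.Integer.Base as ℤ
import Data.Integer.Properties as ℤ
open import Data.List.Base as List using (List; []; _∷_; _∷ʳ_; _++_; length)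
import Data.List.Properties as List
open import Data.List.Membership.Propositional using () renaming (_∈_ to _∈ₗ_; _∉_ to _∉ₗ_)
open import Data.List.Membership.Propositional.Properties using (∈-lookup; ∈-++⁺ˡ; ∈-++⁺ʳ; ∈-filter⁺; ∈-filter⁻; ∈-allFin; ∈-tabulate⁻)
import Data.List.Membership.Setoid.Properties as Membership
open import Data.List.Relation.Unary.All as All using (All; []; _∷_)
open import Data.List.Relation.Unary.Any.Properties using (lookup-index)
open import Data.List.Relation.Unary.Any as Any using (Any; here; there)
open import Data.List.Relation.Unary.AllPairs using ([]; _∷_)
open import Data.List.Relation.Unary.Linked as Linked using (Linked; _∷_)
import Data.List.Relation.Unary.Unique.DecPropositional as DecUnique
open import Data.List.Relation.Unary.Unique.Propositional using (Unique)
import Data.List.Relation.Unary.Unique.Propositional.Properties as Unique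
open import Data.Nat using (ℕ; zero; suc; _+_; _*_; _^_; _≤_; _<_; z≤n; s≤s; NonZero; _≤?_; _<?_; >-nonZero; >-nonZero⁻¹)
open import Data.Nat.Combinatorics using (nC1≡n; nCk+nC[k+1]≡[n+1]C[k+1]) renaming (_C_ to _choose_)
open import Data.Nat.DivMod using (_/_; _%_; _mod_; m≡m%n+[m/n]*n; m%n<n; m<n*o⇒m/o<n; m/n*n≤m; m≥n⇒m/n>0; m/n≤m; [m+kn]%n≡m%n; m<n⇒m%n≡m)
import Data.Nat.Properties as ℕ
open import Data.Nat.Tactic.RingSolver using (solve-∀)
open import Data.Product using (∃; Σ-syntax; ∃-syntax; _×_; _,_; proj₁; proj₂)
import Data.Rational as ℚ
import Data.Rational.Properties as ℚ
import Data.Rational.Unnormalised.Base as ℚᵘ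
import Data.Rational.Unnormalised.Properties as ℚᵘ
open import Data.Sum using (_⊎_; inj₁; inj₂; [_,_]′)
open import Data.Vec using (Vec; []; _∷_; lookup; sum)
import Data.Vec as Vec
import Data.Vec.Properties as Vec
import Data.Vec.Functional as Table
open import Function.Base using (_∘_; id)
open import Relation.Binary.Construct.Closure.ReflexiveTransitive as Star using (Star; ε; _◅_; _◅◅_)
open import Relation.Binary.Definitions using (DecidableEquality)
open import Relation.Binary.PropositionalEquality using (_≡_; _≢_; refl; sym; trans; cong; cong₂; subst; subst₂; ≢-sym; setoid; module ≡-Reasoning)
open import Relation.Nullary using (¬_; Dec; yes; no; does; contradiction; recompute)
open import Relation.Nullary.Decidable using (map′; decidable-stable; dec-true; dec-false; from-yes; _×-dec_; _⊎-dec_; _→-dec_; ¬?)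

-- Trees that meet only in S can share an edge only if it joins two elements of S. Once the edges
-- inside S are allotted in advance, the trees can be chosen greedily, each avoiding the at most two
-- new vertices of every earlier one; so extendability is needed only for a number of vertices
-- bounded in terms of k and ℓ. For large n₁ a random colouring would be extendable as well; the
-- explicit one replaces a probabilistic estimate by a count. A class must realise every list of K
-- rules quoting K letters each, which makes a constant times b ^ (K * K) labels over an alphabet of
-- b letters. With b about the (K * K + 1)-th root of n₁ they fit into a class, while names of
-- constant length still separate all vertices, because n_r is polynomially bounded in n₁. In case
-- (ii) nothing tells which of the two values occurs, and without excluded middle the alternative
-- has to be decided for each graph: hence the exhaustive search over colourings and families of
-- trees.

-- Decidability of rainbow colourability

-- Exhaustive search up to an equivalence; searching up to _≡_ is not enough
-- for records with functional fields.
Searchable : (A : Set) → (A → A → Set) → Set₁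
Searchable A _≈_ = ∀ {P : A → Set} → (∀ {x y} → x ≈ y → P x → P y) →
  (∀ x → Dec (P x)) → Dec (∃ P)

∀-search : ∀ {A _≈_} → Searchable A _≈_ → (∀ {x y} → x ≈ y → y ≈ x) →
  ∀ {P : A → Set} → (∀ {x y} → x ≈ y → P x → P y) →
  (∀ x → Dec (P x)) → Dec (∀ x → P x)
∀-search search ≈-sym resp P? =
  map′ (λ ¬∃ x → decidable-stable (P? x) λ ¬p → ¬∃ (x , ¬p)) (λ p (x , ¬p) → ¬p (p x))
    (¬? (search (λ x≈y ¬px py → ¬px (resp (≈-sym x≈y) py)) (λ x → ¬? (P? x))))

module _ {A : Set} where

  search-vec : Searchable A _≡_ → ∀ n → Searchable (Vec A n) _≡_
  search-vec search zero _ P? = map′ ([] ,_) (λ { ([] , p) → p }) (P? [])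
  search-vec search (suc n) _ P? =
    map′ (λ (x , xs , p) → x ∷ xs , p) (λ { (x ∷ xs , p) → x , xs , p })
      (search (λ { refl → id }) λ x → search-vec search n (λ { refl → id }) (λ xs → P? (x ∷ xs)))

  search-× : ∀ {B} → Searchable A _≡_ → Searchable B _≡_ → Searchable (A × B) _≡_
  search-× searchA searchB _ P? =
    map′ (λ (x , y , p) → (x , y) , p) (λ ((x , y) , p) → x , y , p)
      (searchA (λ { refl → id }) λ x → searchB (λ { refl → id }) (λ y → P? (x , y)))

  -- Without function extensionality a table is only pointwise equal to its head followed by its
  -- tail, so the predicate must respect pointwise equivalence.
  search-table : ∀ {_≈_} → (∀ {x} → x ≈ x) → Searchable A _≈_ →
    ∀ n → Searchable (Fin n → A) (λ f g → ∀ i → f i ≈ g i)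
  search-table ≈-refl search zero resp P? =
    map′ (Table.[] ,_) (λ (f , p) → resp {y = Table.[]} (λ ()) p) (P? Table.[])
  search-table {_≈_} ≈-refl search (suc n) resp P? =
    map′ (λ (x , f , p) → x Table.∷ f , p)
      (λ (f , p) → f zero , f ∘ suc , resp (λ { zero → ≈-refl ; (suc _) → ≈-refl }) p)
      (search (λ x≈y (f , p) → f , resp (λ { zero → x≈y ; (suc _) → ≈-refl }) p)
        λ x → search-table {_≈_} ≈-refl search n
          (λ f≈g → resp (λ { zero → ≈-refl ; (suc i) → f≈g i })) (λ f → P? (x Table.∷ f)))

  -- Subgraphs and colourings carry proofs, so they are searched through raw codes. A code counts
  -- only if it is `Valid`, and `irr` makes the choice of the validity proof immaterial.
  search-retract : ∀ {B _≈_} → Searchable A _≡_ →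
    (Valid : A → Set) (valid? : ∀ a → Dec (Valid a)) (decode : ∀ a → Valid a → B) →
    (∀ a v v′ → decode a v ≈ decode a v′) →
    (encode : B → A) (valid : ∀ b → Valid (encode b)) →
    (∀ b → b ≈ decode (encode b) (valid b)) →
    Searchable B _≈_
  search-retract search Valid valid? decode irr encode valid ≈-decode {P} resp P? =
    map′ (λ (a , v , p) → decode a v , p)
      (λ (b , p) → encode b , valid b , resp (≈-decode b) p)
      (search (λ { refl → id }) P∘decode?)
    where
    P∘decode? : ∀ a → Dec (Σ[ v ∈ Valid a ] P (decode a v))
    P∘decode? a with valid? a
    ... | no ¬v = no (¬v ∘ proj₁)
    ... | yes v = map′ (v ,_) (λ (v′ , p) → resp (irr a v′ v) p) (P? (decode a v))

search-fin : ∀ n → Searchable (Fin n) _≡_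
search-fin n _ = Fin.any?

search-subset : ∀ n → Searchable (Subset n) _≡_
search-subset n _ = Subset.anySubset?

module _ {A : Set} where

  unique-lookup-injective : ∀ {xs : List A} → Unique xs → ∀ {i j} →
    List.lookup xs i ≡ List.lookup xs j → i ≡ j
  unique-lookup-injective (_ ∷ _) {zero} {zero} _ = refl
  unique-lookup-injective (x∉ ∷ _) {zero} {suc j} eq =
    contradiction eq (All.lookup x∉ (∈-lookup j))
  unique-lookup-injective (x∉ ∷ _) {suc i} {zero} eq =
    contradiction (sym eq) (All.lookup x∉ (∈-lookup i))
  unique-lookup-injective (_ ∷ u) {suc i} {suc j} eq = cong suc (unique-lookup-injective u eq)

  unique-⊆⇒length≤ : ∀ {xs ys : List A} → Unique xs → (∀ {x} → x ∈ₗ xs → x ∈ₗ ys) →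
    length xs ≤ length ys
  unique-⊆⇒length≤ {xs} u ⊆ys = Fin.injective⇒≤ {f = λ i → Any.index (⊆ys (∈-lookup {xs = xs} i))}
    λ {i} {j} eq → unique-lookup-injective u
      (Membership.index-injective (setoid A) (⊆ys (∈-lookup i)) (⊆ys (∈-lookup j)) eq)

unique⇒length≤ : ∀ {n} {xs : List (Fin n)} → Unique xs → length xs ≤ n
unique⇒length≤ u = Fin.injective⇒≤ (unique-lookup-injective u)

module _ {n} {E : Fin n → Fin n → Set} (E? : ∀ u v → Dec (E u v)) where

  -- Along each edge that leaves the current set its end is added; strict growth inside `Fin n`
  -- terminates, and a set without exits contains everything reachable.
  reachable-set : ∀ u → Σ[ B ∈ Subset n ] (u ∈ B × (∀ {v} → v ∈ B → Star E u v) ×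
    (∀ {x y} → x ∈ B → E x y → y ∈ B))
  reachable-set u = grow ⁅ u ⁆ (⊃-wellFounded ⁅ u ⁆) (Subset.x∈⁅x⁆ u)
    (λ v∈ → subst (Star E u) (sym (Subset.x∈⁅y⁆⇒x≡y u v∈)) ε)
    where
    grow : ∀ B → Acc _⊃_ B → u ∈ B → (∀ {v} → v ∈ B → Star E u v) →
      Σ[ B ∈ Subset n ] (u ∈ B × (∀ {v} → v ∈ B → Star E u v) × (∀ {x y} → x ∈ B → E x y → y ∈ B))
    grow B (acc rec) u∈B reach with Fin.any? (λ x → Fin.any? (λ y →
      x Subset.∈? B ×-dec E? x y ×-dec ¬? (y Subset.∈? B)))
    ... | no ¬exit = B , u∈B , reach , λ {x} {y} x∈B xy →
      decidable-stable (y Subset.∈? B) λ y∉B → ¬exit (x , y , x∈B , xy , y∉B)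
    ... | yes (x , y , x∈B , xy , y∉B) =
      grow (B ∪ ⁅ y ⁆) (rec (Subset.p⊆p∪q ⁅ y ⁆ , y , y∈ , y∉B)) (Subset.p⊆p∪q ⁅ y ⁆ u∈B) reach′
      where
      y∈ : y ∈ B ∪ ⁅ y ⁆
      y∈ = Subset.q⊆p∪q B ⁅ y ⁆ (Subset.x∈⁅x⁆ y)
      reach′ : ∀ {v} → v ∈ B ∪ ⁅ y ⁆ → Star E u v
      reach′ v∈ with Subset.x∈p∪q⁻ B ⁅ y ⁆ v∈
      ... | inj₁ v∈B = reach v∈B
      ... | inj₂ v∈y rewrite Subset.x∈⁅y⁆⇒x≡y y v∈y = reach x∈B ◅◅ (xy ◅ ε)

  star? : ∀ u v → Dec (Star E u v)
  star? u v with reachable-set u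
  ... | B , u∈B , reach , closed = map′ reach (follow u∈B) (v Subset.∈? B)
    where
    follow : ∀ {x y} → x ∈ B → Star E x y → y ∈ B
    follow x∈B ε = x∈B
    follow x∈B (xy ◅ ys) = follow (closed x∈B xy) ys

module _ {n} {G : Graph n} where

  open Graph G
  open Subgraph

  edge? : (T : Subgraph G) → ∀ u v → Dec (Edge T u v)
  edge? T u v = v Subset.∈? neighbours T u

  connected? : (T : Subgraph G) → Dec (Connected T)
  connected? T = Subset.nonempty? (vertices T) ×-dec
    map′ (λ f {u} {v} → f u v) (λ f u v → f {u} {v})
      (Fin.all? λ u → Fin.all? λ v →
        u Subset.∈? vertices T →-dec v Subset.∈? vertices T →-dec star? (edge? T) u v)

  isCycle? : (T : Subgraph G) → ∀ v vs → Dec (IsCycle T v vs)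
  isCycle? T v vs = 2 ≤? length vs ×-dec DecUnique.unique? Fin._≟_ (v ∷ vs) ×-dec Linked.linked? (edge? T) (v ∷ (vs ∷ʳ v))

  -- The vertices of a cycle are distinct, so the list after the first vertex is shorter than n and
  -- only finitely many lists have to be inspected.
  acyclic? : (T : Subgraph G) → Dec (Acyclic T)
  acyclic? T = map′ (λ ¬c v vs c → ¬c (v , short c)) (λ ¬c (v , _ , vs , c) → ¬c v _ c)
    (¬? (Fin.any? λ v → Fin.any? λ m → search-vec (search-fin n) (toℕ m) (λ { refl → id })
      λ vs → isCycle? T v (Vec.toList vs)))
    where
    short : ∀ {v vs} → IsCycle T v vs →
      ∃[ m ] ∃[ vs ] IsCycle T v (Vec.toList {n = toℕ {n} m} vs)
    short {v} {vs} c@(_ , u , _) =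
      Fin.fromℕ< len , Vec.cast (sym (Fin.toℕ-fromℕ< len)) (Vec.fromList vs) ,
      subst (IsCycle T v) (sym (trans (Vec.toList-cast (sym (Fin.toℕ-fromℕ< len)) (Vec.fromList vs)) (Vec.toList∘fromList vs))) c
      where
      len : length vs < n
      len = unique⇒length≤ u

  infix 4 _≈ᵀ_

  record _≈ᵀ_ (T T′ : Subgraph G) : Set where
    constructor same
    field
      same-vertices : vertices T ≡ vertices T′
      same-neighbours : ∀ u → neighbours T u ≡ neighbours T′ u

  open _≈ᵀ_

  ≈ᵀ-sym : ∀ {T T′} → T ≈ᵀ T′ → T′ ≈ᵀ T
  ≈ᵀ-sym (same v e) = same (sym v) (sym ∘ e)

  ≈ᵀ-edge : ∀ {T T′} → T ≈ᵀ T′ → ∀ {u v} → Edge T u v → Edge T′ u v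
  ≈ᵀ-edge (same _ e) {u} {v} = subst (v ∈_) (e u)

  isTree-resp : ∀ {T T′} → T ≈ᵀ T′ → IsTree T → IsTree T′
  isTree-resp T≈T′@(same refl _) ((ne , conn) , acyc) =
    (ne , λ u∈ v∈ → Star.map (≈ᵀ-edge T≈T′) (conn u∈ v∈)) ,
    λ v vs (len , u , l) → acyc v vs (len , u , Linked.map (≈ᵀ-edge (≈ᵀ-sym T≈T′)) l)

  Code : Set
  Code = Subset n × Vec (Subset n) n

  Valid : Code → Set
  Valid (X , N) = (∀ u v → v ∈ lookup N u → u ∈ lookup N v × u ∈ X × u ∼ v)

  search-subgraph : Searchable (Subgraph G) _≈ᵀ_
  search-subgraph = search-retract
    (search-× (search-subset n) (search-vec (search-subset n) n))
    Valid
    (λ (X , N) → Fin.all? λ u → Fin.all? λ v → v Subset.∈? lookup N u →-dec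
      (u Subset.∈? lookup N v ×-dec u Subset.∈? X ×-dec ∼-dec u v))
    (λ (X , N) valid → record
      { vertices = X ; neighbours = lookup N
      ; neighbour-sym = λ v∈ → proj₁ (valid _ _ v∈)
      ; edge⇒vertex = λ v∈ → proj₁ (proj₂ (valid _ _ v∈))
      ; edge⇒∼ = λ v∈ → proj₂ (proj₂ (valid _ _ v∈)) })
    (λ _ _ _ → same refl λ _ → refl)
    (λ T → vertices T , Vec.tabulate (neighbours T))
    (λ T u v v∈ → let v∈′ = subst (v ∈_) (Vec.lookup∘tabulate (neighbours T) u) v∈ in
      subst (u ∈_) (sym (Vec.lookup∘tabulate (neighbours T) v)) (neighbour-sym T v∈′) ,
      edge⇒vertex T v∈′ , edge⇒∼ T v∈′)
    (λ T → same refl λ u → sym (Vec.lookup∘tabulate (neighbours T) u))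

  module _ {t : ℕ} where

    open EdgeColouring

    infix 4 _≈ᶜ_

    record _≈ᶜ_ (c d : EdgeColouring G t) : Set where
      constructor same-colours
      field
        agree : ∀ u v (e : u ∼ v) → colour c u v e ≡ colour d u v e

    open _≈ᶜ_

    rainbow? : (c : EdgeColouring G t) (T : Subgraph G) → Dec (Rainbow c T)
    rainbow? c T = map′ (λ f {u} {v} {x} {y} → f u v x y) (λ f u v x y → f {u} {v} {x} {y})
      (Fin.all? λ u → Fin.all? λ v → Fin.all? λ x → Fin.all? λ y → pair? u v x y)
      where
      pair? : ∀ u v x y → Dec ((e : Edge T u v) (f : Edge T x y) →
        colour c u v (edge⇒∼ T e) ≡ colour c x y (edge⇒∼ T f) → (u ≡ x × v ≡ y) ⊎ (u ≡ y × v ≡ x))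
      pair? u v x y with edge? T u v | edge? T x y
      ... | no ¬e | _ = yes λ e → contradiction e ¬e
      ... | yes _ | no ¬f = yes λ _ f → contradiction f ¬f
      ... | yes e | yes f = map′ (λ p _ _ → p) (λ p → p e f)
        (colour c u v (edge⇒∼ T e) Fin.≟ colour c x y (edge⇒∼ T f) →-dec
          ((u Fin.≟ x ×-dec v Fin.≟ y) ⊎-dec (u Fin.≟ y ×-dec v Fin.≟ x)))

    rainbow-resp : ∀ {c d T T′} → c ≈ᶜ d → T ≈ᵀ T′ → Rainbow c T → Rainbow d T′
    rainbow-resp {T = T} {T′} c≈d T≈T′ rb {u} {v} {x} {y} e f eq =
      rb (≈ᵀ-edge T′≈T e) (≈ᵀ-edge T′≈T f)
        (trans (agree c≈d u v (edge⇒∼ T′ e)) (trans eq (sym (agree c≈d x y (edge⇒∼ T′ f)))))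
      where
      T′≈T : T′ ≈ᵀ T
      T′≈T = ≈ᵀ-sym T≈T′

    isRainbowSTree? : (c : EdgeColouring G t) (S : Subset n) (T : Subgraph G) → Dec (IsRainbowSTree c S T)
    isRainbowSTree? c S T = (connected? T ×-dec acyclic? T) ×-dec S Subset.⊆? vertices T ×-dec rainbow? c T

    isRainbowSTree-resp : ∀ {c d S T T′} → c ≈ᶜ d → T ≈ᵀ T′ → IsRainbowSTree c S T → IsRainbowSTree d S T′
    isRainbowSTree-resp c≈d T≈T′@(same refl _) (tree , S⊆ , rb) =
      isTree-resp T≈T′ tree , S⊆ , rainbow-resp c≈d T≈T′ rb

  module _ {ℓ : ℕ} {S : Subset n} where

    internallyDisjoint? : (T : Fin ℓ → Subgraph G) → Dec (InternallyDisjoint S T)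
    internallyDisjoint? T = map′ (λ f {i} {j} → f i j) (λ f i j → f {i} {j})
      (Fin.all? λ i → Fin.all? λ j → ¬? (i Fin.≟ j) →-dec
        ((Fin.all? λ u → Fin.all? λ v → edge? (T i) u v →-dec ¬? (edge? (T j) u v)) ×-dec
         (Vec.≡-dec Bool._≟_ (vertices (T i) ∩ vertices (T j)) S)))

    internallyDisjoint-resp : ∀ {T T′ : Fin ℓ → Subgraph G} → (∀ i → T i ≈ᵀ T′ i) →
      InternallyDisjoint S T → InternallyDisjoint S T′
    internallyDisjoint-resp T≈T′ disj {i} {j} i≢j =
      (λ u v e f → proj₁ (disj i≢j) u v (≈ᵀ-edge (≈ᵀ-sym (T≈T′ i)) e) (≈ᵀ-edge (≈ᵀ-sym (T≈T′ j)) f)) ,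
      subst₂ (λ X Y → X ∩ Y ≡ S) (same-vertices (T≈T′ i)) (same-vertices (T≈T′ j)) (proj₂ (disj i≢j))

  search-colouring : ∀ t → Searchable (EdgeColouring G (suc t)) _≈ᶜ_
  search-colouring t = search-retract
    (search-vec (search-vec (search-fin (suc t)) n) n)
    (λ m → ∀ u v → u ∼ v → entry m u v ≡ entry m v u)
    (λ m → Fin.all? λ u → Fin.all? λ v → ∼-dec u v →-dec (entry m u v Fin.≟ entry m v u))
    (λ m valid → record
      { colour = λ u v _ → entry m u v
      -- The adjacency proof is irrelevant here, so the equation is recovered by deciding it.
      ; colour-sym = λ u v e → recompute (entry m u v Fin.≟ entry m v u) (valid u v e) })
    (λ _ _ _ → same-colours λ _ _ _ → refl)
    (λ c → Vec.tabulate (λ u → Vec.tabulate (colour⁺ c u)))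
    (λ c u v e → trans (sym (≡-entry c u v e)) (trans (colour-sym c u v e) (≡-entry c v u (∼-sym e))))
    (λ c → same-colours (≡-entry c))
    where
    open EdgeColouring
    entry : Vec (Vec (Fin (suc t)) n) n → Fin n → Fin n → Fin (suc t)
    entry m u v = lookup (lookup m u) v
    colour⁺ : EdgeColouring G (suc t) → Fin n → Fin n → Fin (suc t)
    colour⁺ c u v with ∼-dec u v
    ... | yes e = colour c u v e
    -- A colour matrix needs entries at non-adjacent pairs too; this default is why at least one
    -- colour is assumed.
    ... | no _ = zero
    ≡-colour⁺ : ∀ c u v (e : u ∼ v) → colour c u v e ≡ colour⁺ c u v
    ≡-colour⁺ c u v e with ∼-dec u v
    ... | yes _ = refl
    ... | no ¬e = contradiction e ¬e
    ≡-entry : ∀ c u v (e : u ∼ v) →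
      colour c u v e ≡ entry (Vec.tabulate (λ u → Vec.tabulate (colour⁺ c u))) u v
    ≡-entry c u v e = trans (≡-colour⁺ c u v e) (sym (trans
      (cong (λ row → lookup row v) (Vec.lookup∘tabulate (λ u → Vec.tabulate (colour⁺ c u)) u))
      (Vec.lookup∘tabulate (colour⁺ c u) v)))

  rainbowColourable? : ∀ k ℓ t → Dec (RainbowColourable k ℓ G (suc t))
  rainbowColourable? k ℓ t = search-colouring t
    (λ c≈d good S ∣S∣≡k → let T , tree , disj = good S ∣S∣≡k in
      T , (λ i → isRainbowSTree-resp {S = S} {T i} {T i} c≈d (same refl λ _ → refl) (tree i)) , disj)
    λ c → ∀-search (search-subset n) sym (λ { refl → id }) λ S → ∣ S ∣ ℕ.≟ k →-dec
      search-table {_≈_ = _≈ᵀ_} (same refl λ _ → refl) search-subgraph ℓ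
        (λ T≈T′ (tree , disj) →
          (λ i → isRainbowSTree-resp {c = c} {d = c} {S = S} (same-colours λ _ _ _ → refl) (T≈T′ i) (tree i)) ,
          (λ {i} {j} → internallyDisjoint-resp {S = S} T≈T′ (λ {i} {j} → disj {i} {j}) {i} {j}))
        (λ T → (Fin.all? λ i → isRainbowSTree? c S (T i)) ×-dec internallyDisjoint? T)

-- Lower bounds

subset-index : ∀ {n x} {S : Subset n} → x ∈ S → Fin ∣ S ∣
subset-index {S = inside ∷ S} Vec.here = zero
subset-index {S = inside ∷ S} (Vec.there x∈S) = suc (subset-index x∈S)
subset-index {S = outside ∷ S} (Vec.there x∈S) = subset-index x∈S

subset-index-injective : ∀ {n x y} {S : Subset n} (x∈S : x ∈ S) (y∈S : y ∈ S) →
  subset-index x∈S ≡ subset-index y∈S → x ≡ y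
subset-index-injective {S = inside ∷ S} Vec.here Vec.here _ = refl
subset-index-injective {S = inside ∷ S} (Vec.there x∈S) (Vec.there y∈S) eq =
  cong suc (subset-index-injective x∈S y∈S (Fin.suc-injective eq))
subset-index-injective {S = outside ∷ S} (Vec.there x∈S) (Vec.there y∈S) eq =
  cong suc (subset-index-injective x∈S y∈S eq)

elements : ∀ {n} → Subset n → List (Fin n)
elements {n} S = List.filter (Subset._∈? S) (List.allFin n)

∈⇒∈-elements : ∀ {n x} {S : Subset n} → x ∈ S → x ∈ₗ elements S
∈⇒∈-elements {S = S} x∈S = ∈-filter⁺ (Subset._∈? S) (∈-allFin _) x∈S

length-elements≤ : ∀ {n} (S : Subset n) → length (elements S) ≤ ∣ S ∣
length-elements≤ {n} S = Fin.injective⇒≤ {f = λ i → subset-index (∈S i)} λ {i} {j} eq →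
  unique-lookup-injective (Unique.filter⁺ (Subset._∈? S) (Unique.allFin⁺ n))
    (subset-index-injective (∈S i) (∈S j) eq)
  where
  ∈S : ∀ i → List.lookup (elements S) i ∈ S
  ∈S i = proj₂ (∈-filter⁻ (Subset._∈? S) {xs = List.allFin n} (∈-lookup {xs = elements S} i))

∣⁅x⁆∪p∣ : ∀ {n x} {S : Subset n} → x ∉ S → ∣ ⁅ x ⁆ ∪ S ∣ ≡ suc ∣ S ∣
∣⁅x⁆∪p∣ {x = zero} {inside ∷ S} x∉S = contradiction Vec.here x∉S
∣⁅x⁆∪p∣ {x = zero} {outside ∷ S} x∉S = cong (suc ∘ ∣_∣) (Subset.∪-identityˡ S)
∣⁅x⁆∪p∣ {x = suc x} {inside ∷ S} x∉S = cong suc (∣⁅x⁆∪p∣ (x∉S ∘ Vec.there))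
∣⁅x⁆∪p∣ {x = suc x} {outside ∷ S} x∉S = ∣⁅x⁆∪p∣ (x∉S ∘ Vec.there)

subset-image : ∀ {n k} (f : Fin k → Fin n) → (∀ {i j} → f i ≡ f j → i ≡ j) →
  Σ[ S ∈ Subset n ] (∣ S ∣ ≡ k × (∀ i → f i ∈ S) × (∀ {x} → x ∈ S → ∃[ i ] f i ≡ x))
subset-image {n} {zero} f _ =
  ∅ , Subset.∣⊥∣≡0 n , (λ ()) , λ x∈ → contradiction x∈ Subset.∉⊥
subset-image {n} {suc k} f inj with subset-image (f ∘ suc) (Fin.suc-injective ∘ inj)
... | S , ∣S∣≡k , f∈ , onto = ⁅ f zero ⁆ ∪ S , trans (∣⁅x⁆∪p∣ f0∉S) (cong suc ∣S∣≡k) , f∈′ , onto′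
  where
  f0∉S : f zero ∉ S
  f0∉S f0∈S with onto f0∈S
  ... | i , eq = contradiction (inj eq) λ ()
  f∈′ : ∀ i → f i ∈ ⁅ f zero ⁆ ∪ S
  f∈′ zero = Subset.p⊆p∪q S (Subset.x∈⁅x⁆ (f zero))
  f∈′ (suc i) = Subset.q⊆p∪q ⁅ f zero ⁆ S (f∈ i)
  onto′ : ∀ {x} → x ∈ ⁅ f zero ⁆ ∪ S → ∃[ i ] f i ≡ x
  onto′ x∈ with Subset.x∈p∪q⁻ ⁅ f zero ⁆ S x∈
  ... | inj₁ x∈f0 = zero , sym (Subset.x∈⁅y⁆⇒x≡y (f zero) x∈f0)
  ... | inj₂ x∈S with onto x∈S
  ...   | i , eq = suc i , eq

-- The number of vertices of a rainbow tree

module _ {n t} {G : Graph n} (c : EdgeColouring G t) (T : Subgraph G) where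

  open Subgraph T
  open EdgeColouring c

  -- The state of a search through T: every visited vertex except the root is charged to the colour
  -- of the edge that reached it.
  record Explored : Set where
    field
      visited : List (Fin n)
      colours : List (Fin t)
      distinct : Unique colours
      balance : length visited ≡ suc (length colours)
      witness : ∀ {γ} → γ ∈ₗ colours → ∃[ u ] ∃[ v ] Σ[ e ∈ Edge u v ]
        (u ∈ₗ visited × v ∈ₗ visited × γ ≡ colour u v (edge⇒∼ e))

  open Explored

  module _ (rainbow : Rainbow c T) where

    -- The colour of an edge to an unvisited vertex is fresh: had it occurred, rainbowness would
    -- identify the edge with one whose ends are both visited.
    explore-edge : ∀ (X : Explored) {a b} → a ∈ₗ visited X → Edge a b →
      Σ[ Y ∈ Explored ] ((∀ {x} → x ∈ₗ visited X → x ∈ₗ visited Y) × b ∈ₗ visited Y)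
    explore-edge X {a} {b} a∈ e with Any.any? (b Fin.≟_) (visited X)
    ... | yes b∈ = X , id , b∈
    ... | no b∉ = record
      { visited = b ∷ visited X
      ; colours = colour a b (edge⇒∼ e) ∷ colours X
      ; distinct = All.tabulate fresh ∷ distinct X
      ; balance = cong suc (balance X)
      ; witness = λ
        { (here refl) → a , b , e , there a∈ , here refl , refl
        ; (there γ∈) → let u , v , f , u∈ , v∈ , eq = witness X γ∈ in
                       u , v , f , there u∈ , there v∈ , eq }
      } , there , here refl
      where
      fresh : ∀ {γ} → γ ∈ₗ colours X → colour a b (edge⇒∼ e) ≢ γ
      fresh γ∈ eq with witness X γ∈
      ... | u , v , f , u∈ , v∈ , γ≡ with rainbow e f (trans eq γ≡)
      ... | inj₁ (_ , refl) = b∉ v∈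
      ... | inj₂ (_ , refl) = b∉ u∈

    explore-walk : ∀ (X : Explored) {a b} → a ∈ₗ visited X → Star Edge a b →
      Σ[ Y ∈ Explored ] ((∀ {x} → x ∈ₗ visited X → x ∈ₗ visited Y) × b ∈ₗ visited Y)
    explore-walk X a∈ ε = X , id , a∈
    explore-walk X a∈ (e ◅ es) with explore-edge X a∈ e
    ... | Y , ⊆Y , b∈ with explore-walk Y b∈ es
    ... | Z , ⊆Z , z∈ = Z , ⊆Z ∘ ⊆Y , z∈

    explore-all : Connected T → ∀ xs → (∀ {x} → x ∈ₗ xs → x ∈ vertices) →
      Σ[ Y ∈ Explored ] ((∃[ r ] (r ∈ₗ visited Y × r ∈ vertices)) × (∀ {x} → x ∈ₗ xs → x ∈ₗ visited Y))
    explore-all ((r , r∈) , _) [] _ = record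
      { visited = r ∷ [] ; colours = [] ; distinct = [] ; balance = refl ; witness = λ () } ,
      (r , here refl , r∈) , λ ()
    explore-all conn (x ∷ xs) ⊆V with explore-all conn xs (⊆V ∘ there)
    ... | X , (r , r∈X , r∈) , ⊆X with explore-walk X r∈X (proj₂ conn r∈ (⊆V (here refl)))
    ... | Y , ⊆Y , x∈ = Y , (r , ⊆Y r∈X , r∈) , λ { (here refl) → x∈ ; (there y∈) → ⊆Y (⊆X y∈) }

    rainbow⇒length≤ : Connected T → ∀ {xs} → Unique xs → (∀ {x} → x ∈ₗ xs → x ∈ vertices) →
      length xs ≤ suc t
    rainbow⇒length≤ conn {xs} u ⊆V with explore-all conn xs ⊆V
    ... | X , _ , ⊆X = ℕ.≤-trans (unique-⊆⇒length≤ u ⊆X)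
      (subst (_≤ suc t) (sym (balance X)) (s≤s (unique⇒length≤ (distinct X))))

-- Class and position as coordinates of a vertex

position : ∀ {r} (ns : Vec ℕ r) → Fin (sum ns) → ℕ
position (n ∷ ns) v = [ toℕ , position ns ]′ (Fin.splitAt n v)

vertex : ∀ {r} (ns : Vec ℕ r) a → Fin (lookup ns a) → Fin (sum ns)
vertex (n ∷ ns) zero i = i Fin.↑ˡ sum ns
vertex (n ∷ ns) (suc a) i = n Fin.↑ʳ vertex ns a i

class-vertex : ∀ {r} (ns : Vec ℕ r) a i → class ns (vertex ns a i) ≡ a
class-vertex (n ∷ ns) zero i rewrite Fin.splitAt-↑ˡ n i (sum ns) = refl
class-vertex (n ∷ ns) (suc a) i rewrite Fin.splitAt-↑ʳ n (sum ns) (vertex ns a i) =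
  cong suc (class-vertex ns a i)

position-vertex : ∀ {r} (ns : Vec ℕ r) a i → position ns (vertex ns a i) ≡ toℕ i
position-vertex (n ∷ ns) zero i rewrite Fin.splitAt-↑ˡ n i (sum ns) = refl
position-vertex (n ∷ ns) (suc a) i rewrite Fin.splitAt-↑ʳ n (sum ns) (vertex ns a i) =
  position-vertex ns a i

class-position-injective : ∀ {r} (ns : Vec ℕ r) {u v} →
  class ns u ≡ class ns v → position ns u ≡ position ns v → u ≡ v
class-position-injective (n ∷ ns) {u} {v} c p
  with Fin.splitAt n u in eu | Fin.splitAt n v in ev
... | inj₁ i | inj₁ j = trans (sym (Fin.splitAt⁻¹-↑ˡ eu))
  (trans (cong (Fin._↑ˡ sum ns) (Fin.toℕ-injective p)) (Fin.splitAt⁻¹-↑ˡ ev))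
... | inj₂ i | inj₂ j = trans (sym (Fin.splitAt⁻¹-↑ʳ eu))
  (trans (cong (n Fin.↑ʳ_) (class-position-injective ns (Fin.suc-injective c) p)) (Fin.splitAt⁻¹-↑ʳ ev))

module _ {n} {G : Graph n} (T : Subgraph G) where

  open Subgraph T

  connected⇒neighbour : Connected T → ∀ {u v} → u ∈ vertices → v ∈ vertices → u ≢ v →
    ∃[ y ] (Edge u y × y ∈ vertices)
  connected⇒neighbour (_ , walk) u∈ v∈ u≢v with walk u∈ v∈
  ... | ε = contradiction refl u≢v
  ... | e ◅ _ = _ , e , edge⇒vertex (neighbour-sym e)

module _ {r} (ns : Vec ℕ r) {k ℓ s : ℕ} where

  open Subgraph

  -- A set S inside one class spans no edge, so an S-tree has at least k edges.
  k≤colours : ∀ a → k ≤ lookup ns a → 2 ≤ k → 1 ≤ ℓ → RainbowColourable k ℓ (K ns) s → k ≤ s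
  k≤colours a k≤ 2≤k (s≤s _) (c , trees) =
    let S , ∣S∣≡k , f∈ , _ = subset-image f f-injective
        T , tree , _ = trees S ∣S∣≡k
        (conn , _) , S⊆ , rainbow = tree zero
        -- A neighbour of an element of S lies outside class `a`, hence outside S, so the tree has k
        -- + 1 vertices.
        y , e , y∈ = connected⇒neighbour (T zero) conn (S⊆ (f∈ i₀)) (S⊆ (f∈ i₁)) (i₀≢i₁ ∘ f-injective)
        y∉f : ∀ i → y ≢ f i
        y∉f = λ i y≡fi → edge⇒∼ (T zero) e
          (trans (class-vertex ns a _) (sym (trans (cong (class ns) y≡fi) (class-vertex ns a _))))
        unique = All.tabulate (λ x∈ y≡x → let i , x≡fi = ∈-tabulate⁻ x∈ in y∉f i (trans y≡x x≡fi)) ∷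
          Unique.tabulate⁺ f-injective
        bound = rainbow⇒length≤ c (T zero) rainbow conn unique λ
          { (here refl) → y∈
          ; (there x∈) → let i , x≡fi = ∈-tabulate⁻ x∈ in subst (_∈ vertices (T zero)) (sym x≡fi) (S⊆ (f∈ i)) }
    in ℕ.≤-pred (subst (_≤ suc s) (cong suc (List.length-tabulate f)) bound)
    where
    f : Fin k → Fin (sum ns)
    f i = vertex ns a (Fin.inject≤ i k≤)
    f-injective : ∀ {i j} → f i ≡ f j → i ≡ j
    f-injective eq = Fin.inject≤-injective k≤ k≤ _ _ (Fin.toℕ-injective
      (trans (sym (position-vertex ns a _)) (trans (cong (position ns) eq) (position-vertex ns a _))))
    i₀ i₁ : Fin k
    i₀ = Fin.fromℕ< (ℕ.≤-trans (s≤s z≤n) 2≤k)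
    i₁ = Fin.fromℕ< 2≤k
    i₀≢i₁ : i₀ ≢ i₁
    i₀≢i₁ eq with trans (sym (Fin.toℕ-fromℕ< (ℕ.≤-trans (s≤s z≤n) 2≤k)))
      (trans (cong toℕ eq) (Fin.toℕ-fromℕ< 2≤k))
    ... | ()

k≤⌈k/r⌉*r : ∀ k r .{{_ : NonZero r}} → k ≤ ⌈ k / r ⌉ * r
k≤⌈k/r⌉*r k r@(suc r-1) = ℕ.+-cancelʳ-≤ r-1 k (⌈ k / r ⌉ * r) (begin
  k + r-1                            ≡⟨ m≡m%n+[m/n]*n (k + r-1) r ⟩
  (k + r-1) % r + ⌈ k / r ⌉ * r      ≤⟨ ℕ.+-monoˡ-≤ _ (ℕ.≤-pred (m%n<n (k + r-1) r)) ⟩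
  r-1 + ⌈ k / r ⌉ * r                ≡⟨ ℕ.+-comm r-1 _ ⟩
  ⌈ k / r ⌉ * r + r-1                ∎)
  where open ℕ.≤-Reasoning

module _ {r-1} (ns : Vec ℕ (suc r-1)) {k ℓ s : ℕ} where

  open Subgraph

  private
    r q Q : ℕ
    r = suc r-1
    q = k / r
    Q = ⌈ k / r ⌉

  -- A balanced set S.  An S-tree on at most k + 1 vertices has at most one
  -- vertex w outside S, so the k / r vertices of S in the class of w have all
  -- their tree edges inside S.  Counting the edges of S in both directions
  -- gives the bound.
  module _ (2≤k : 2 ≤ k) (k≤ : ∀ a → k ≤ lookup ns a) (s≤k : s ≤ k) where

    private
      i₀ i₁ : Fin k
      i₀ = Fin.fromℕ< (ℕ.≤-trans (s≤s z≤n) 2≤k)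
      i₁ = Fin.fromℕ< 2≤k

      i₀≢i₁ : i₀ ≢ i₁
      i₀≢i₁ eq with trans (sym (Fin.toℕ-fromℕ< (ℕ.≤-trans (s≤s z≤n) 2≤k)))
        (trans (cong toℕ eq) (Fin.toℕ-fromℕ< 2≤k))
      ... | ()

      row<Q : ∀ (m : Fin k) → toℕ m / r < Q
      row<Q m = m<n*o⇒m/o<n (ℕ.<-≤-trans (Fin.toℕ<n m) (k≤⌈k/r⌉*r k r))

      row<size : ∀ (m : Fin k) a → toℕ m / r < lookup ns a
      row<size m a = ℕ.≤-<-trans (m/n≤m (toℕ m) r) (ℕ.<-≤-trans (Fin.toℕ<n m) (k≤ a))

      -- S is dealt out to the classes in turn: all its positions are below `Q`, and every class
      -- receives at least `q` elements.
      g : Fin k → Fin (sum ns)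
      g m = vertex ns (toℕ m mod r) (Fin.fromℕ< (row<size m (toℕ m mod r)))

      class-g : ∀ m → toℕ (class ns (g m)) ≡ toℕ m % r
      class-g m = trans (cong toℕ (class-vertex ns (toℕ m mod r) _)) (Fin.toℕ-fromℕ< (m%n<n (toℕ m) r))

      position-g : ∀ m → position ns (g m) ≡ toℕ m / r
      position-g m = trans (position-vertex ns (toℕ m mod r) _) (Fin.toℕ-fromℕ< _)

      g-injective : ∀ {m m′} → g m ≡ g m′ → m ≡ m′
      g-injective {m} {m′} eq = Fin.toℕ-injective (begin
        toℕ m                               ≡⟨ m≡m%n+[m/n]*n (toℕ m) r ⟩
        toℕ m % r + toℕ m / r * r           ≡⟨ cong₂ (λ x y → x + y * r)
          (trans (sym (class-g m)) (trans (cong (toℕ ∘ class ns) eq) (class-g m′)))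
          (trans (sym (position-g m)) (trans (cong (position ns) eq) (position-g m′))) ⟩
        toℕ m′ % r + toℕ m′ / r * r         ≡⟨ m≡m%n+[m/n]*n (toℕ m′) r ⟨
        toℕ m′                              ∎)
        where open ≡-Reasoning

      cell<k : ∀ (a : Fin r) (j : Fin q) → toℕ a + toℕ j * r < k
      cell<k a j = begin-strict
        toℕ a + toℕ j * r  <⟨ ℕ.+-monoˡ-< (toℕ j * r) (Fin.toℕ<n a) ⟩
        suc (toℕ j) * r    ≤⟨ ℕ.*-monoˡ-≤ r (Fin.toℕ<n j) ⟩
        q * r              ≤⟨ m/n*n≤m k r ⟩
        k                  ∎
        where open ℕ.≤-Reasoning

      -- The j-th element of S in class `a` is the one dealt out at time a + j r; it exists for all
      -- j < `q`.
      cell : Fin r → Fin q → Fin (sum ns)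
      cell a j = g (Fin.fromℕ< (cell<k a j))

      class-cell : ∀ a j → class ns (cell a j) ≡ a
      class-cell a j = Fin.toℕ-injective (begin
        toℕ (class ns (cell a j))                    ≡⟨ class-g (Fin.fromℕ< (cell<k a j)) ⟩
        toℕ (Fin.fromℕ< (cell<k a j)) % r            ≡⟨ cong (_% r) (Fin.toℕ-fromℕ< (cell<k a j)) ⟩
        (toℕ a + toℕ j * r) % r                      ≡⟨ [m+kn]%n≡m%n (toℕ a) (toℕ j) r ⟩
        toℕ a % r                                    ≡⟨ m<n⇒m%n≡m (Fin.toℕ<n a) ⟩
        toℕ a                                        ∎)
        where open ≡-Reasoning

      cell-injective : ∀ a {j j′} → cell a j ≡ cell a j′ → j ≡ j′
      cell-injective a {j} {j′} eq = Fin.toℕ-injective (ℕ.*-cancelʳ-≡ _ _ r (ℕ.+-cancelˡ-≡ (toℕ a) _ _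
        (Fin.fromℕ<-injective _ _ (cell<k a j) (cell<k a j′) (g-injective eq))))

    module _ (S : Subset (sum ns)) (g∈ : ∀ m → g m ∈ S) (onto : ∀ {x} → x ∈ S → ∃[ m ] g m ≡ x)
      (c : EdgeColouring (K ns) s) (T : Fin ℓ → Subgraph (K ns))
      (trees : ∀ i → IsRainbowSTree c S (T i)) (disjoint : InternallyDisjoint S T) where

      private
        S⊆ : ∀ i → S ⊆ vertices (T i)
        S⊆ i = proj₁ (proj₂ (trees i))

        conn : ∀ i → Connected (T i)
        conn i = proj₁ (proj₁ (trees i))

        at-most-one-extra : ∀ i {w y} → w ∈ vertices (T i) → w ∉ S → y ∈ vertices (T i) → y ∉ S → y ≡ w
        at-most-one-extra i {w} {y} w∈ w∉S y∈ y∉S = decidable-stable (y Fin.≟ w) λ y≢w →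
          let unique = (y≢w ∷ All.tabulate (∉g y∉S)) ∷ All.tabulate (∉g w∉S) ∷ Unique.tabulate⁺ g-injective
              bound = rainbow⇒length≤ c (T i) (proj₂ (proj₂ (trees i))) (conn i) unique λ
                { (here refl) → y∈
                ; (there (here refl)) → w∈
                ; (there (there x∈)) → let m , x≡gm = ∈-tabulate⁻ x∈ in
                    subst (_∈ vertices (T i)) (sym x≡gm) (S⊆ i (g∈ m)) }
          in ℕ.<⇒≱ (s≤s s≤k) (ℕ.≤-pred (subst (λ l → suc (suc l) ≤ suc s) (List.length-tabulate g) bound))
          where
          ∉g : ∀ {z} → z ∉ S → ∀ {x} → x ∈ₗ List.tabulate g → z ≢ x
          ∉g z∉S x∈ refl = let m , z≡gm = ∈-tabulate⁻ x∈ in z∉S (subst (_∈ S) (sym z≡gm) (g∈ m))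

        extra-class : ∀ i → Σ[ a ∈ Fin r ] (∀ {y} → y ∈ vertices (T i) → class ns y ≢ a → y ∈ S)
        extra-class i with Fin.any? (λ w → w Subset.∈? vertices (T i) ×-dec ¬? (w Subset.∈? S))
        -- With no vertex outside S every class has the property, and `zero` is an arbitrary choice.
        ... | no none = zero , λ {y} y∈ _ → decidable-stable (y Subset.∈? S) λ y∉S → none (y , y∈ , y∉S)
        ... | yes (w , w∈ , w∉S) = class ns w , λ {y} y∈ cy≢cw → decidable-stable (y Subset.∈? S) λ y∉S →
          cy≢cw (cong (class ns) (at-most-one-extra i w∈ w∉S y∈ y∉S))

        tail : Fin ℓ → Fin q → Fin (sum ns)
        tail i j = cell (proj₁ (extra-class i)) j

        tail∈S : ∀ i j → tail i j ∈ S
        tail∈S i j = g∈ (Fin.fromℕ< (cell<k (proj₁ (extra-class i)) j))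

        out-edge : ∀ i j → ∃[ y ] (Edge (T i) (tail i j) y × y ∈ S)
        out-edge i j =
          let v , v∈S , tail≢v = other (tail i j Fin.≟ g i₀)
              y , e , y∈ = connected⇒neighbour (T i) (conn i) (S⊆ i (tail∈S i j)) (S⊆ i v∈S) tail≢v
          in y , e , proj₂ (extra-class i) y∈ λ cy≡a →
            edge⇒∼ (T i) e (trans (class-cell (proj₁ (extra-class i)) j) (sym cy≡a))
          where
          -- A walk that leaves the tail needs a different end; of two elements of S at least one is
          -- different.
          other : Dec (tail i j ≡ g i₀) → ∃[ v ] (v ∈ S × tail i j ≢ v)
          other (no ≢g₀) = g i₀ , g∈ i₀ , ≢g₀
          other (yes ≡g₀) = g i₁ , g∈ i₁ , λ ≡g₁ → i₀≢i₁ (g-injective (trans (sym ≡g₀) ≡g₁))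

        head : Fin ℓ → Fin q → Fin (sum ns)
        head i j = proj₁ (out-edge i j)

        -- Edges inside S are counted with both orientations, so that the bound becomes a product
        -- and no unordered pairs have to be coded.
        record Dart : Set where
          field
            start end : Fin (sum ns)
            start∈S : start ∈ S
            end∈S : end ∈ S
            adjacent : class ns start ≢ class ns end

        open Dart

        dart : Fin ℓ → Fin q → Fin 2 → Dart
        dart i j zero = record
          { start = tail i j ; end = head i j
          ; start∈S = tail∈S i j ; end∈S = proj₂ (proj₂ (out-edge i j))
          ; adjacent = edge⇒∼ (T i) (proj₁ (proj₂ (out-edge i j))) }
        dart i j (suc zero) = record
          { start = head i j ; end = tail i j
          ; start∈S = proj₂ (proj₂ (out-edge i j)) ; end∈S = tail∈S i j
          ; adjacent = ≢-sym (edge⇒∼ (T i) (proj₁ (proj₂ (out-edge i j)))) }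

        dart-edge : ∀ i j o → Edge (T i) (start (dart i j o)) (end (dart i j o))
        dart-edge i j zero = proj₁ (proj₂ (out-edge i j))
        dart-edge i j (suc zero) = neighbour-sym (T i) (proj₁ (proj₂ (out-edge i j)))

        tail≢head : ∀ i j j′ → tail i j ≢ head i j′
        tail≢head i j j′ eq = edge⇒∼ (T i) (proj₁ (proj₂ (out-edge i j′)))
          (trans (class-cell (proj₁ (extra-class i)) j′)
            (trans (sym (class-cell (proj₁ (extra-class i)) j)) (cong (class ns) eq)))

        -- Different trees share no edge. Within one tree all tails lie in one class and no head
        -- does, so the orientation is visible, and the tail determines its index.
        dart-injective : ∀ i j o i′ j′ o′ →
          start (dart i j o) ≡ start (dart i′ j′ o′) → end (dart i j o) ≡ end (dart i′ j′ o′) →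
          (i , j , o) ≡ (i′ , j′ , o′)
        dart-injective i j o i′ j′ o′ s≡ e≡ with i Fin.≟ i′
        ... | no i≢i′ = contradiction
          (subst₂ (Edge (T i′)) (sym s≡) (sym e≡) (dart-edge i′ j′ o′))
          (proj₁ (disjoint i≢i′) _ _ (dart-edge i j o))
        dart-injective i j zero i j′ zero s≡ e≡ | yes refl =
          cong (λ j → i , j , zero) (cell-injective (proj₁ (extra-class i)) s≡)
        dart-injective i j zero i j′ (suc zero) s≡ e≡ | yes refl = contradiction s≡ (tail≢head i j j′)
        dart-injective i j (suc zero) i j′ zero s≡ e≡ | yes refl = contradiction (sym s≡) (tail≢head i j′ j)
        dart-injective i j (suc zero) i j′ (suc zero) s≡ e≡ | yes refl =
          cong (λ j → i , j , suc zero) (cell-injective (proj₁ (extra-class i)) e≡)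

        position<Q : ∀ {x} → x ∈ S → position ns x < Q
        position<Q x∈S with onto x∈S
        ... | m , refl = subst (_< Q) (sym (position-g m)) (row<Q m)

        -- The factor `r-1` comes from `punchOut`: the class of the end ranges over all classes but
        -- that of the start. Each position ranges over `Q` values.
        code : Dart → Fin (r * (r-1 * (Q * Q)))
        code d = Fin.combine (class ns (start d)) (Fin.combine (Fin.punchOut (adjacent d))
          (Fin.combine (Fin.fromℕ< (position<Q (start∈S d))) (Fin.fromℕ< (position<Q (end∈S d)))))

        code-injective : ∀ d d′ → code d ≡ code d′ → start d ≡ start d′ × end d ≡ end d′
        code-injective d d′ eq =
          let c≡ , eq₁ = Fin.combine-injective (class ns (start d)) _ (class ns (start d′)) _ eq
              p≡ , eq₂ = Fin.combine-injective (Fin.punchOut (adjacent d)) _ (Fin.punchOut (adjacent d′)) _ eq₁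
              x≡ , y≡ = Fin.combine-injective
                (Fin.fromℕ< (position<Q (start∈S d))) (Fin.fromℕ< (position<Q (end∈S d)))
                (Fin.fromℕ< (position<Q (start∈S d′))) (Fin.fromℕ< (position<Q (end∈S d′))) eq₂
          in class-position-injective ns c≡ (Fin.fromℕ<-injective _ _ _ _ x≡) ,
             class-position-injective ns (punchOut-injective′ c≡ (adjacent d) (adjacent d′) p≡)
               (Fin.fromℕ<-injective _ _ _ _ y≡)
          where
          punchOut-injective′ : ∀ {a a′ b b′ : Fin r} → a ≡ a′ → (p : a ≢ b) (p′ : a′ ≢ b′) →
            Fin.punchOut p ≡ Fin.punchOut p′ → b ≡ b′
          punchOut-injective′ refl p p′ = Fin.punchOut-injective p p′

        split : Fin (ℓ * (q * 2)) → Fin ℓ × Fin q × Fin 2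
        split x = let i , y = Fin.remQuot {ℓ} (q * 2) x ; j , o = Fin.remQuot {q} 2 y in i , j , o

        join : Fin ℓ × Fin q × Fin 2 → Fin (ℓ * (q * 2))
        join (i , j , o) = Fin.combine i (Fin.combine j o)

        join-split : ∀ x → join (split x) ≡ x
        join-split x = let i , y = Fin.remQuot {ℓ} (q * 2) x in
          trans (cong (Fin.combine i) (Fin.combine-remQuot {q} 2 y)) (Fin.combine-remQuot {ℓ} (q * 2) x)

      darts≤ : ℓ * (q * 2) ≤ r * (r-1 * (Q * Q))
      darts≤ = Fin.injective⇒≤ {f = λ x → let i , j , o = split x in code (dart i j o)} λ {x} {y} eq →
        let i , j , o = split x
            i′ , j′ , o′ = split y
            s≡ , e≡ = code-injective (dart i j o) (dart i′ j′ o′) eq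
        in trans (sym (join-split x)) (trans (cong join (dart-injective i j o i′ j′ o′ s≡ e≡)) (join-split y))

    -- This is twice the inequality ℓ ⌊k/r⌋ ≤ binom(r,2) ⌈k/r⌉², whose failure is the hypothesis of
    -- case (iii).
    few-colours⇒ℓ-bound : RainbowColourable k ℓ (K ns) s → ℓ * (q * 2) ≤ r * (r-1 * (Q * Q))
    few-colours⇒ℓ-bound (c , trees) =
      let S , ∣S∣≡k , g∈ , onto = subset-image g g-injective
          T , tree , disjoint = trees S ∣S∣≡k
      in darts≤ S g∈ onto c T tree disjoint

-- Extendable colourings

-- Repetitions are allowed: what matters is that `decode` reaches every element, so that `size`
-- positions suffice to realise all of them.
record Enumeration (A : Set) : Set where
  field
    size : ℕ
    decode : Fin size → A
    encode : A → Fin size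
    decode-encode : ∀ a → decode (encode a) ≡ a

open Enumeration

enum-fin : ∀ n → Enumeration (Fin n)
enum-fin n = record { size = n ; decode = id ; encode = id ; decode-encode = λ _ → refl }

enum-× : ∀ {A B} → Enumeration A → Enumeration B → Enumeration (A × B)
enum-× EA EB = record
  { size = size EA * size EB
  ; decode = λ i → let x , y = Fin.remQuot {size EA} (size EB) i in decode EA x , decode EB y
  ; encode = λ (a , b) → Fin.combine (encode EA a) (encode EB b)
  ; decode-encode = λ (a , b) → trans
      (cong (λ (x , y) → decode EA x , decode EB y) (Fin.remQuot-combine (encode EA a) (encode EB b)))
      (cong₂ _,_ (decode-encode EA a) (decode-encode EB b)) }

enum-vec : ∀ {A} → Enumeration A → ∀ m → Enumeration (Vec A m)
enum-vec E zero = record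
  { size = 1 ; decode = λ _ → [] ; encode = λ _ → zero ; decode-encode = λ { [] → refl } }
enum-vec E (suc m) = let E′ = enum-× E (enum-vec E m) in record
  { size = size E′
  ; decode = λ i → let x , xs = decode E′ i in x ∷ xs
  ; encode = λ { (x ∷ xs) → encode E′ (x , xs) }
  ; decode-encode = λ { (x ∷ xs) → cong (λ (y , ys) → y ∷ ys) (decode-encode E′ (x , xs)) } }

size-enum-vec : ∀ {A} (E : Enumeration A) m → size (enum-vec E m) ≡ size E ^ m
size-enum-vec E zero = refl
size-enum-vec E (suc m) = cong (size E *_) (size-enum-vec E m)

-- K letters of the name of x separate it from K given elements, so a list of K
-- rules (pattern , colour) is enough to prescribe the colours of K elements.
module DecisionList {V : Set} (_≟_ : DecidableEquality V) (L b t-1 K : ℕ) (letter : V → Fin L → Fin b)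
  (differ : ∀ x y → Σ[ p ∈ Fin L ] (x ≢ y → letter x p ≢ letter y p)) where

  Pattern Rule : Set
  Pattern = Vec (Fin L × Fin b) K
  Rule = Pattern × Fin (suc t-1)

  Matches : Pattern → V → Set
  Matches pat v = ∀ i → letter v (proj₁ (lookup pat i)) ≡ proj₂ (lookup pat i)

  matches? : ∀ pat v → Dec (Matches pat v)
  matches? pat v = Fin.all? λ i → letter v (proj₁ (lookup pat i)) Fin.≟ proj₂ (lookup pat i)

  eval : ∀ {m} → Vec Rule m → V → Fin (suc t-1)
  eval [] v = zero
  eval ((pat , c) ∷ rules) v = if does (matches? pat v) then c else eval rules v

  module _ (xs : Vec V K) (τ : V → Fin (suc t-1)) where

    separator : V → V → Fin L × Fin b
    separator x y = proj₁ (differ x y) , letter x (proj₁ (differ x y))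

    pattern-for : V → Pattern
    pattern-for x = Vec.map (separator x) xs

    pattern-self : ∀ x → Matches (pattern-for x) x
    pattern-self x i rewrite Vec.lookup-map i (separator x) xs = refl

    -- The j-th entry of the pattern quotes a letter at which x would differ from `lookup xs j` if
    -- the two were distinct.
    pattern-only : ∀ x j → Matches (pattern-for x) (lookup xs j) → x ≡ lookup xs j
    pattern-only x j match = decidable-stable (x ≟ lookup xs j) λ x≢y →
      proj₂ (differ x (lookup xs j)) x≢y (sym
        (subst (λ (p , l) → letter (lookup xs j) p ≡ l) (Vec.lookup-map j (separator x) xs) (match j)))

    rule-for : V → Rule
    rule-for x = pattern-for x , τ x

    -- An earlier rule that fires at a vertex of `xs` does so because it was made for that very
    -- vertex, so it returns the right colour. The rules run through `ys` while the patterns still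
    -- separate from all of `xs`, as the induction requires.
    eval-sublist : ∀ {m} (ys : Vec V m) i j → lookup ys i ≡ lookup xs j →
      eval (Vec.map rule-for ys) (lookup xs j) ≡ τ (lookup xs j)
    eval-sublist (x ∷ ys) i j eq = step (matches? (pattern-for x) (lookup xs j)) i eq
      where
      step : ∀ (match? : Dec (Matches (pattern-for x) (lookup xs j))) i → lookup (x ∷ ys) i ≡ lookup xs j →
        (if does match? then τ x else eval (Vec.map rule-for ys) (lookup xs j)) ≡ τ (lookup xs j)
      step (yes match) _ _ = cong τ (pattern-only x j match)
      step (no ¬match) zero eq = contradiction (subst (Matches (pattern-for x)) eq (pattern-self x)) ¬match
      step (no _) (suc i) eq = eval-sublist ys i j eq

    interpolate : Vec Rule K
    interpolate = Vec.map rule-for xs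

    eval-interpolate : ∀ j → eval interpolate (lookup xs j) ≡ τ (lookup xs j)
    eval-interpolate j = eval-sublist xs j j refl

  enum-rules : Enumeration (Vec Rule K)
  enum-rules = enum-vec (enum-× (enum-vec (enum-× (enum-fin L) (enum-fin b)) K) (enum-fin (suc t-1))) K

avoid : ∀ {m R} → m < R → (f : Fin m → Fin R) → ∃[ i ] ∀ j → f j ≢ i
avoid {m} {R} m<R f with Fin.any? (λ i → Fin.all? λ j → ¬? (f j Fin.≟ i))
... | yes found = found
... | no none = contradiction (Fin.injective⇒≤ {f = proj₁ ∘ hit} (λ {i} {i′} eq →
    trans (sym (proj₂ (hit i))) (trans (cong f eq) (proj₂ (hit i′))))) (ℕ.<⇒≱ m<R)
  where
  hit : ∀ i → ∃[ j ] f j ≡ i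
  hit i with Fin.any? (λ j → f j Fin.≟ i)
  ... | yes j = j
  ... | no ¬j = contradiction (i , λ j eq → ¬j (j , eq)) none

-- Colours are prescribed by a function of the vertex, so repetitions in `xs` cannot conflict. The
-- colouring is total: colours are also prescribed at vertices of class `a`, where there is no edge.
Extendable : ∀ {n r t} → (Fin n → Fin r) → (Fin n → Fin n → Fin t) → ℕ → Set
Extendable {n} {r} {t} cls colour K =
  ∀ (xs : List (Fin n)) → length xs ≤ K → (τ : Fin n → Fin t) (a : Fin r) →
  ∃[ w ] (cls w ≡ a × w ∉ₗ xs × (∀ {x} → x ∈ₗ xs → colour w x ≡ τ x))

-- For an edge u v at most one end evaluates its own decision list at the other
-- end: u does so if the tier of v occurs in the reading list of u but not
-- conversely.  A vertex whose reading list consists of the tiers of K given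
-- vertices and whose tier occurs in none of their reading lists is thus free to
-- choose the colours of its K edges to them.
module ExtendableColouring {n r : ℕ} (cls : Fin n → Fin r) (L b t-1 K : ℕ) (letter : Fin n → Fin L → Fin b)
  (differ : ∀ x y → Σ[ p ∈ Fin L ] (x ≢ y → letter x p ≢ letter y p)) where

  open DecisionList Fin._≟_ L b t-1 K letter differ

  -- K vertices block at most K (K + 1) tiers: their own and the K entries of each of their reading
  -- lists. One more leaves a free tier.
  R : ℕ
  R = suc (K * suc K)

  Label : Set
  Label = Fin R × Vec (Fin R) K × Vec Rule K

  enum-label : Enumeration Label
  enum-label = enum-× (enum-fin R) (enum-× (enum-vec (enum-fin R) K) enum-rules)

  -- A pattern exists only if there are letters and positions; `differ x x` supplies a position, its
  -- separation property being vacuous.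
  default-label : Fin n → Label
  default-label x = zero , Vec.replicate K zero ,
    Vec.replicate K (Vec.replicate K (proj₁ (differ x x) , letter x (proj₁ (differ x x))) , zero)

  module _ (origin : Fin n) (label : Fin n → Label) (hub : ∀ a l → ∃[ w ] (cls w ≡ a × label w ≡ l)) where

    tier : Fin n → Fin R
    tier u = proj₁ (label u)

    reading-list : Fin n → Vec (Fin R) K
    reading-list u = proj₁ (proj₂ (label u))

    rules : Fin n → Vec Rule K
    rules u = proj₂ (proj₂ (label u))

    reads? : ∀ u v → Dec (∃[ j ] lookup (reading-list u) j ≡ tier v)
    reads? u v = Fin.any? λ j → lookup (reading-list u) j Fin.≟ tier v

    select : Bool → Bool → Fin (suc t-1) → Fin (suc t-1) → Fin (suc t-1)
    select true false c d = c
    select false true c d = d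
    -- If both ends or neither would read the other, a fixed colour keeps the colouring symmetric.
    select true true _ _ = zero
    select false false _ _ = zero

    select-comm : ∀ p q c d → select p q c d ≡ select q p d c
    select-comm true true _ _ = refl
    select-comm true false _ _ = refl
    select-comm false true _ _ = refl
    select-comm false false _ _ = refl

    colouring : Fin n → Fin n → Fin (suc t-1)
    colouring u v = select (does (reads? u v)) (does (reads? v u)) (eval (rules u) v) (eval (rules v) u)

    colouring-sym : ∀ u v → colouring u v ≡ colouring v u
    colouring-sym u v = select-comm (does (reads? u v)) (does (reads? v u)) _ _

    extend-vec : ∀ (xs : Vec (Fin n) K) (τ : Fin n → Fin (suc t-1)) a →
      ∃[ w ] (cls w ≡ a × (∀ j → w ≢ lookup xs j × colouring w (lookup xs j) ≡ τ (lookup xs j)))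
    extend-vec xs τ a =
      -- The tier i is not the tier of any of the K vertices, so w is none of them, and it occurs in
      -- none of their reading lists, so none of them reads w.
      let i , i-fresh = avoid ℕ.≤-refl used-tier
          w , cw≡a , label≡ = hub a (i , Vec.map tier xs , interpolate xs τ)
      in w , cw≡a , λ j →
        (λ w≡x → fresh i i-fresh j zero (trans (cong tier (sym w≡x)) (cong proj₁ label≡))) ,
        (begin
          colouring w (lookup xs j)
        ≡⟨ cong₂ (λ p q → select p q (eval (rules w) (lookup xs j)) (eval (rules (lookup xs j)) w))
             (dec-true (reads? w (lookup xs j)) (j , (trans
               (cong (λ l → lookup (proj₁ (proj₂ l)) j) label≡) (Vec.lookup-map j tier xs))))
             (dec-false (reads? (lookup xs j) w) λ (o , eq) →
               fresh i i-fresh j (suc o) (trans eq (cong proj₁ label≡))) ⟩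
          eval (rules w) (lookup xs j)
        ≡⟨ cong (λ l → eval (proj₂ (proj₂ l)) (lookup xs j)) label≡ ⟩
          eval (interpolate xs τ) (lookup xs j)
        ≡⟨ eval-interpolate xs τ j ⟩
          τ (lookup xs j)
        ∎)
      where
      open ≡-Reasoning
      tiers : Fin n → Fin (suc K) → Fin R
      tiers x = lookup (tier x ∷ reading-list x)
      used-tier : Fin (K * suc K) → Fin R
      used-tier jo = let j , o = Fin.remQuot {K} (suc K) jo in tiers (lookup xs j) o
      fresh : ∀ i → (∀ jo → used-tier jo ≢ i) → ∀ j o → tiers (lookup xs j) o ≢ i
      fresh i i-fresh j o eq = i-fresh (Fin.combine j o)
        (trans (cong (λ (j , o) → tiers (lookup xs j) o) (Fin.remQuot-combine j o)) eq)

    private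
      -- Labels hold exactly K rules, so shorter lists are filled up with a dummy vertex;
      -- prescribing its colour as well does no harm.
      pad : Fin n → ∀ m → List (Fin n) → Vec (Fin n) m
      pad d zero _ = []
      pad d (suc m) [] = d ∷ pad d m []
      pad d (suc m) (x ∷ xs) = x ∷ pad d m xs

      ∈-pad : ∀ d {m xs x} → length xs ≤ m → x ∈ₗ xs → ∃[ j ] lookup (pad d m xs) j ≡ x
      ∈-pad d (s≤s _) (here refl) = zero , refl
      ∈-pad d (s≤s len) (there x∈) = let j , eq = ∈-pad d len x∈ in suc j , eq

    extendable : Extendable cls colouring K
    extendable xs len τ a =
      let w , cw≡a , good = extend-vec (pad origin K xs) τ a
      in w , cw≡a ,
        (λ w∈ → let j , eq = ∈-pad origin len w∈ in proj₁ (good j) (sym eq)) ,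
        (λ x∈ → let j , eq = ∈-pad origin len x∈ in subst (λ x → colouring w x ≡ τ x) eq (proj₂ (good j)))

-- Packing rainbow trees

-- A walk that never turns back in a forest climbs towards the root and then
-- descends; a closed one would have to end with the edge it started with.
module ParentForest {n} {G : Graph n} (T : Subgraph G) (Child : Fin n → Fin n → Set) (rank : Fin n → ℕ)
  (functional : ∀ {x y z} → Child x y → Child x z → y ≡ z)
  (decreasing : ∀ {x y} → Child x y → rank y < rank x)
  (oriented : ∀ {x y} → Subgraph.Edge T x y → Child x y ⊎ Child y x) where

  open Subgraph T using (Edge)

  private
    NoTurn : Fin n → Fin n → List (Fin n) → Fin n → Set
    NoTurn a b [] z = a ≢ z
    NoTurn a b (c ∷ zs) z = a ≢ c × NoTurn b c zs z

    unique⇒noTurn : ∀ {a b zs z} → Unique (a ∷ b ∷ zs) → z ∉ₗ a ∷ b ∷ zs → NoTurn a b zs z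
    unique⇒noTurn {zs = []} u z∉ a≡z = z∉ (here (sym a≡z))
    unique⇒noTurn {zs = c ∷ zs} ((_ ∷ a≢c ∷ _) ∷ u) z∉ = a≢c , unique⇒noTurn u (z∉ ∘ there)

    -- After a step down from a to b the only way up leads back to a, the unique parent of b, which
    -- `NoTurn` forbids; so the walk descends to its end.
    descend : ∀ {a b} zs {z} → Linked Edge (a ∷ b ∷ (zs ∷ʳ z)) → NoTurn a b zs z → Child b a →
      rank a < rank z × ∃[ y ] (y ∈ₗ b ∷ zs × Child z y)
    descend [] (_ ∷ bz ∷ _) a≢z ba with oriented bz
    ... | inj₁ b-z = contradiction (functional ba b-z) a≢z
    ... | inj₂ zb = ℕ.<-trans (decreasing ba) (decreasing zb) , _ , here refl , zb
    descend (c ∷ zs) (_ ∷ bc ∷ l) (a≢c , nt) ba with oriented bc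
    ... | inj₁ b-c = contradiction (functional ba b-c) a≢c
    ... | inj₂ cb with descend zs (bc ∷ l) nt cb
    ...   | rank< , y , y∈ , zy = ℕ.<-trans (decreasing ba) rank< , y , there y∈ , zy

    -- Either every step climbs and the rank drops, or the walk descends from some point on and
    -- enters z from its parent.
    ascend : ∀ {a b} zs {z} → Linked Edge (a ∷ b ∷ (zs ∷ʳ z)) → NoTurn a b zs z →
      rank z < rank a ⊎ ∃[ y ] (y ∈ₗ b ∷ zs × Child z y)
    ascend zs l@(ab ∷ _) nt with oriented ab
    ascend zs l nt | inj₂ ba = inj₂ (proj₂ (descend zs l nt ba))
    ascend [] (_ ∷ bz ∷ _) nt | inj₁ a-b with oriented bz
    ... | inj₁ b-z = inj₁ (ℕ.<-trans (decreasing b-z) (decreasing a-b))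
    ... | inj₂ zb = inj₂ (_ , here refl , zb)
    ascend (c ∷ zs) (_ ∷ l) (_ , nt) | inj₁ a-b with ascend zs l nt
    ... | inj₁ rank< = inj₁ (ℕ.<-trans rank< (decreasing a-b))
    ... | inj₂ (y , y∈ , zy) = inj₂ (y , there y∈ , zy)

  acyclic : Acyclic T
  acyclic v (_ ∷ []) (s≤s () , _)
  acyclic v (b ∷ c ∷ zs) (_ , u@((_ ∷ v≢c ∷ _) ∷ u′@(b≢ ∷ _)) , l@(vb ∷ l′)) with oriented vb
  ... | inj₂ bv = ℕ.<-irrefl refl (proj₁ (descend (c ∷ zs) l (v≢c , noTurn) bv))
    where noTurn = unique⇒noTurn u′ (Unique.Unique[x∷xs]⇒x∉xs u)
  ... | inj₁ v-b with ascend zs l′ (unique⇒noTurn u′ (Unique.Unique[x∷xs]⇒x∉xs u))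
  ...   | inj₁ rank< = ℕ.<-asym rank< (decreasing v-b)
  -- The walk returns to v from the parent of v, which is b; but b does not recur on the cycle.
  ...   | inj₂ (y , y∈ , vy) = All.lookup b≢ y∈ (functional v-b vy)

module _ {n} {P : Fin n → Set} (P? : ∀ x → Dec (P x)) where

  comprehension : Subset n
  comprehension = Vec.tabulate (λ x → does (P? x))

  ∈-comprehension⁺ : ∀ {x} → P x → x ∈ comprehension
  ∈-comprehension⁺ {x} px = Vec.lookup⇒[]= x _ (trans (Vec.lookup∘tabulate _ x) (dec-true (P? x) px))

  ∈-comprehension⁻ : ∀ {x} → x ∈ comprehension → P x
  ∈-comprehension⁻ {x} x∈ with P? x in eq
  ... | yes px = px
  ... | no _ = contradiction (trans (sym (Vec.[]=⇒lookup x∈))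
    (trans (Vec.lookup∘tabulate _ x) (cong does eq))) λ ()

symmetricColouring : ∀ {n t} {G : Graph n} (f : Fin n → Fin n → Fin t) → (∀ u v → f u v ≡ f v u) → EdgeColouring G t
symmetricColouring f f-sym = record { colour = λ u v _ → f u v ; colour-sym = λ u v _ → f-sym u v }

-- An S-tree that may be used next to trees whose vertices outside S lie in
-- `used`; its edges inside S are confined to F.
record Piece {n t} {G : Graph n} (c : EdgeColouring G t) (S : Subset n)
  (used : List (Fin n)) (F : Fin n → Fin n → Set) : Set where
  field
    tree : Subgraph G
    isTree : IsRainbowSTree c S tree
    extras : List (Fin n)
    few : length extras ≤ 2
    fresh : ∀ {x} → x ∈ₗ extras → x ∉ₗ used
    covers : ∀ {x} → x ∈ Subgraph.vertices tree → x ∈ S ⊎ x ∈ₗ extras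
    inner : ∀ {u v} → Subgraph.Edge tree u v → u ∉ S ⊎ v ∉ S ⊎ F u v

module _ {n t} {G : Graph n} (c : EdgeColouring G t) (S : Subset n) where

  open Piece

  -- A greedy choice: each piece lengthens `used` by at most two vertices, so the budget of two per
  -- remaining piece is maintained.
  pack : ∀ {ℓ} bound (F : Fin ℓ → Fin n → Fin n → Set) →
    (∀ i used → length used ≤ bound → Piece c S used (F i)) →
    ∀ used → length used + ℓ * 2 ≤ bound →
    Σ[ piece ∈ (∀ i → Piece c S used (F i)) ]
      (∀ {i j} → i ≢ j → ∀ {x} → x ∈ₗ extras (piece i) → x ∉ₗ extras (piece j))
  pack {zero} bound F step used len = (λ ()) , λ { {()} }
  pack {suc ℓ} bound F step used len = piece , apart
    where
    first-piece : Piece c S used (F zero)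
    first-piece = step zero used (ℕ.m+n≤o⇒m≤o (length used) len)
    len′ : length (extras first-piece ++ used) + ℓ * 2 ≤ bound
    len′ = begin
      length (extras first-piece ++ used) + ℓ * 2
        ≡⟨ cong (_+ ℓ * 2) (List.length-++ (extras first-piece)) ⟩
      length (extras first-piece) + length used + ℓ * 2
        ≤⟨ ℕ.+-monoˡ-≤ (ℓ * 2) (ℕ.+-monoˡ-≤ (length used) (few first-piece)) ⟩
      2 + length used + ℓ * 2
        ≡⟨ rearrange (length used) (ℓ * 2) ⟩
      length used + suc ℓ * 2
        ≤⟨ len ⟩
      bound ∎
      where
      open ℕ.≤-Reasoning
      rearrange : ∀ a b → 2 + a + b ≡ a + (2 + b)
      rearrange = solve-∀
    rest : Σ[ piece ∈ (∀ i → Piece c S (extras first-piece ++ used) (F (suc i))) ]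
      (∀ {i j} → i ≢ j → ∀ {x} → x ∈ₗ extras (piece i) → x ∉ₗ extras (piece j))
    rest = pack bound (F ∘ suc) (step ∘ suc) (extras first-piece ++ used) len′
    weaken : ∀ {F} → Piece c S (extras first-piece ++ used) F → Piece c S used F
    weaken p = record
      { tree = tree p ; isTree = isTree p ; extras = extras p ; few = few p
      ; fresh = λ x∈ → fresh p x∈ ∘ ∈-++⁺ʳ (extras first-piece)
      ; covers = covers p ; inner = inner p }
    piece : ∀ i → Piece c S used (F i)
    piece zero = first-piece
    piece (suc i) = weaken (proj₁ rest i)
    apart : ∀ {i j} → i ≢ j → ∀ {x} → x ∈ₗ extras (piece i) → x ∉ₗ extras (piece j)
    apart {zero} {zero} i≢j _ _ = i≢j refl
    apart {zero} {suc j} _ x∈i x∈j = fresh (proj₁ rest j) x∈j (∈-++⁺ˡ x∈i)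
    apart {suc i} {zero} _ x∈i x∈j = fresh (proj₁ rest i) x∈i (∈-++⁺ˡ x∈j)
    apart {suc i} {suc j} i≢j x∈i x∈j = proj₂ rest (i≢j ∘ cong suc) x∈i x∈j

  -- Two pieces meet only in S, so a common edge would have both ends in S and belong to two of the
  -- disjoint allotments.
  pieces⇒trees : ∀ ℓ (F : Fin ℓ → Fin n → Fin n → Set) →
    (∀ {i j} → i ≢ j → ∀ {u v} → F i u v → ¬ F j u v) →
    (∀ i used → length used ≤ ℓ * 2 → Piece c S used (F i)) →
    Σ[ T ∈ (Fin ℓ → Subgraph G) ] ((∀ i → IsRainbowSTree c S (T i)) × InternallyDisjoint S T)
  pieces⇒trees ℓ F F-disjoint step with pack (ℓ * 2) F step [] ℕ.≤-refl
  ... | piece , apart = tree ∘ piece , isTree ∘ piece , λ i≢j → edges-disjoint i≢j , meet i≢j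
    where
    open Subgraph
    common : ∀ {i j} → i ≢ j → ∀ {x} → x ∈ vertices (tree (piece i)) → x ∈ vertices (tree (piece j)) → x ∈ S
    common {i} {j} i≢j x∈i x∈j with covers (piece i) x∈i | covers (piece j) x∈j
    ... | inj₁ x∈S | _ = x∈S
    ... | inj₂ _ | inj₁ x∈S = x∈S
    ... | inj₂ x∈ex | inj₂ x∈ex′ = contradiction x∈ex′ (apart i≢j x∈ex)
    source : ∀ i {u v} → Edge (tree (piece i)) u v → u ∈ vertices (tree (piece i))
    source i = edge⇒vertex (tree (piece i))
    target : ∀ i {u v} → Edge (tree (piece i)) u v → v ∈ vertices (tree (piece i))
    target i e = edge⇒vertex (tree (piece i)) (neighbour-sym (tree (piece i)) e)
    edges-disjoint : ∀ {i j} → i ≢ j → ∀ u v → Edge (tree (piece i)) u v → ¬ Edge (tree (piece j)) u v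
    edges-disjoint {i} {j} i≢j u v e f with inner (piece i) e | inner (piece j) f
    ... | inj₁ u∉S | _ = u∉S (common i≢j (source i e) (source j f))
    ... | inj₂ (inj₁ v∉S) | _ = v∉S (common i≢j (target i e) (target j f))
    ... | inj₂ (inj₂ _) | inj₁ u∉S = u∉S (common i≢j (source i e) (source j f))
    ... | inj₂ (inj₂ _) | inj₂ (inj₁ v∉S) = v∉S (common i≢j (target i e) (target j f))
    ... | inj₂ (inj₂ Fi) | inj₂ (inj₂ Fj) = F-disjoint i≢j Fi Fj
    meet : ∀ {i j} → i ≢ j → vertices (tree (piece i)) ∩ vertices (tree (piece j)) ≡ S
    meet {i} {j} i≢j = Subset.⊆-antisym
      (λ x∈ → let x∈i , x∈j = Subset.x∈p∩q⁻ _ _ x∈ in common i≢j x∈i x∈j)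
      (λ x∈S → Subset.x∈p∩q⁺
        (proj₁ (proj₂ (isTree (piece i))) x∈S , proj₁ (proj₂ (isTree (piece j))) x∈S))

-- All upper bounds use this shape: ρ is a second new vertex if there are k + 1
-- colours and lies in S otherwise (a star or a path).
module DoubleStar {r t} (ns : Vec ℕ r) (f : Fin (sum ns) → Fin (sum ns) → Fin t) (f-sym : ∀ u v → f u v ≡ f v u)
  (S : Subset (sum ns)) (ρ w : Fin (sum ns)) (cρ≢cw : class ns ρ ≢ class ns w) where

  private
    V : Set
    V = Fin (sum ns)

  SameClass? : ∀ x → Dec (class ns x ≡ class ns w)
  SameClass? x = class ns x Fin.≟ class ns w

  InTree : V → Set
  InTree x = x ∈ S ⊎ x ≡ ρ ⊎ x ≡ w

  inTree? : ∀ x → Dec (InTree x)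
  inTree? x = x Subset.∈? S ⊎-dec x Fin.≟ ρ ⊎-dec x Fin.≟ w

  -- The root is ρ and w hangs from it. Vertices in the class of w cannot be joined to w and hang
  -- from ρ; all others hang from w, which keeps the edges at ρ few in case ρ lies in S.
  data Child : V → V → Set where
    hang-ρ : ∀ {x} → InTree x → x ≢ ρ → class ns x ≡ class ns w → Child x ρ
    hang-w : ∀ {x} → InTree x → x ≢ ρ → class ns x ≢ class ns w → Child x w

  child? : ∀ x y → Dec (Child x y)
  child? x y with inTree? x | x Fin.≟ ρ | SameClass? x
  ... | no x∉ | _ | _ = no λ { (hang-ρ x∈ _ _) → x∉ x∈ ; (hang-w x∈ _ _) → x∉ x∈ }
  ... | yes _ | yes x≡ρ | _ = no λ { (hang-ρ _ x≢ρ _) → x≢ρ x≡ρ ; (hang-w _ x≢ρ _) → x≢ρ x≡ρ }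
  ... | yes x∈ | no x≢ρ | yes c = map′ (λ { refl → hang-ρ x∈ x≢ρ c })
    (λ { (hang-ρ _ _ _) → refl ; (hang-w _ _ ¬c) → contradiction c ¬c }) (y Fin.≟ ρ)
  ... | yes x∈ | no x≢ρ | no ¬c = map′ (λ { refl → hang-w x∈ x≢ρ ¬c })
    (λ { (hang-ρ _ _ c) → contradiction c ¬c ; (hang-w _ _ _) → refl }) (y Fin.≟ w)

  Adjacent : V → V → Set
  Adjacent u v = Child u v ⊎ Child v u

  adjacent? : ∀ u v → Dec (Adjacent u v)
  adjacent? u v = child? u v ⊎-dec child? v u

  swap : ∀ {u v} → Adjacent u v → Adjacent v u
  swap (inj₁ uv) = inj₂ uv
  swap (inj₂ vu) = inj₁ vu

  child-∈ : ∀ {x y} → Child x y → InTree x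
  child-∈ (hang-ρ x∈ _ _) = x∈
  child-∈ (hang-w x∈ _ _) = x∈

  child-≢ρ : ∀ {x y} → Child x y → x ≢ ρ
  child-≢ρ (hang-ρ _ x≢ρ _) = x≢ρ
  child-≢ρ (hang-w _ x≢ρ _) = x≢ρ

  parent-∈ : ∀ {x y} → Child x y → InTree y
  parent-∈ (hang-ρ _ _ _) = inj₂ (inj₁ refl)
  parent-∈ (hang-w _ _ _) = inj₂ (inj₂ refl)

  child-∼ : ∀ {x y} → Child x y → class ns x ≢ class ns y
  child-∼ (hang-ρ _ _ cx≡cw) cx≡cρ = cρ≢cw (trans (sym cx≡cρ) cx≡cw)
  child-∼ (hang-w _ _ cx≢cw) cx≡cw = cx≢cw cx≡cw

  doubleStar : Subgraph (K ns)
  doubleStar = record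
    { vertices = comprehension inTree?
    ; neighbours = λ u → comprehension (adjacent? u)
    ; neighbour-sym = λ {u} {v} v∈ → ∈-comprehension⁺ (adjacent? v) (swap (∈-comprehension⁻ (adjacent? u) v∈))
    ; edge⇒vertex = λ {u} v∈ → ∈-comprehension⁺ inTree?
        ([ child-∈ , parent-∈ ]′ (∈-comprehension⁻ (adjacent? u) v∈))
    ; edge⇒∼ = λ {u} v∈ → [ child-∼ , (λ c → ≢-sym (child-∼ c)) ]′ (∈-comprehension⁻ (adjacent? u) v∈)
    }

  open Subgraph doubleStar

  child⇒edge : ∀ {x y} → Child x y → Edge x y
  child⇒edge {x} xy = ∈-comprehension⁺ (adjacent? x) (inj₁ xy)

  edge⇒child : ∀ {x y} → Edge x y → Adjacent x y
  edge⇒child {x} = ∈-comprehension⁻ (adjacent? x)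

  to-root : ∀ {x} → InTree x → Star Edge x ρ
  to-root {x} x∈ with x Fin.≟ ρ | SameClass? x
  ... | yes refl | _ = ε
  ... | no x≢ρ | yes c = child⇒edge (hang-ρ x∈ x≢ρ c) ◅ ε
  ... | no x≢ρ | no ¬c = child⇒edge (hang-w x∈ x≢ρ ¬c) ◅
    child⇒edge (hang-ρ (inj₂ (inj₂ refl)) (λ w≡ρ → cρ≢cw (cong (class ns) (sym w≡ρ))) refl) ◅ ε

  connected : Connected doubleStar
  connected = (ρ , ∈-comprehension⁺ inTree? (inj₂ (inj₁ refl))) , λ u∈ v∈ →
    to-root (∈-comprehension⁻ inTree? u∈) ◅◅
    Star.reverse neighbour-sym (to-root (∈-comprehension⁻ inTree? v∈))

  rank : V → ℕ
  rank x = if does (x Fin.≟ ρ) then 0 else if does (SameClass? x) then 1 else 2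

  rank-decreasing : ∀ {x y} → Child x y → rank y < rank x
  rank-decreasing {x} (hang-ρ _ x≢ρ c)
    rewrite dec-true (ρ Fin.≟ ρ) refl | dec-false (x Fin.≟ ρ) x≢ρ | dec-true (SameClass? x) c = s≤s z≤n
  rank-decreasing {x} (hang-w _ x≢ρ ¬c)
    rewrite dec-false (w Fin.≟ ρ) (λ w≡ρ → cρ≢cw (cong (class ns) (sym w≡ρ))) | dec-true (SameClass? w) refl
      | dec-false (x Fin.≟ ρ) x≢ρ | dec-false (SameClass? x) ¬c = s≤s (s≤s z≤n)

  child-functional : ∀ {x y z} → Child x y → Child x z → y ≡ z
  child-functional (hang-ρ _ _ _) (hang-ρ _ _ _) = refl
  child-functional (hang-ρ _ _ c) (hang-w _ _ ¬c) = contradiction c ¬c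
  child-functional (hang-w _ _ ¬c) (hang-ρ _ _ c) = contradiction c ¬c
  child-functional (hang-w _ _ _) (hang-w _ _ _) = refl

  module _ (label : V → Fin t) (label-edge : ∀ {x y} → Child x y → f x y ≡ label x)
    (label-injective : ∀ {x y} → InTree x → x ≢ ρ → InTree y → y ≢ ρ → label x ≡ label y → x ≡ y) where

    private
      lower : ∀ {u v} → Adjacent u v → ∃[ x ] ∃[ y ] (Child x y × f u v ≡ label x × ((u ≡ x × v ≡ y) ⊎ (u ≡ y × v ≡ x)))
      lower {u} {v} (inj₁ uv) = u , v , uv , label-edge uv , inj₁ (refl , refl)
      lower {u} {v} (inj₂ vu) = v , u , vu , trans (f-sym u v) (label-edge vu) , inj₂ (refl , refl)

      same-edge : ∀ {u v u′ v′ x y : V} → (u ≡ x × v ≡ y) ⊎ (u ≡ y × v ≡ x) →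
        (u′ ≡ x × v′ ≡ y) ⊎ (u′ ≡ y × v′ ≡ x) → (u ≡ u′ × v ≡ v′) ⊎ (u ≡ v′ × v ≡ u′)
      same-edge (inj₁ (refl , refl)) (inj₁ (refl , refl)) = inj₁ (refl , refl)
      same-edge (inj₁ (refl , refl)) (inj₂ (refl , refl)) = inj₂ (refl , refl)
      same-edge (inj₂ (refl , refl)) (inj₁ (refl , refl)) = inj₂ (refl , refl)
      same-edge (inj₂ (refl , refl)) (inj₂ (refl , refl)) = inj₁ (refl , refl)

    -- Every edge is the parent edge of its lower end and has the label of that end as its colour,
    -- so equal colours give equal lower ends and hence equal edges.
    rainbow : Rainbow (symmetricColouring f f-sym) doubleStar
    rainbow e e′ eq with lower (edge⇒child e) | lower (edge⇒child e′)
    ... | x , y , xy , l , uv | x′ , y′ , xy′ , l′ , uv′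
      with label-injective (child-∈ xy) (child-≢ρ xy) (child-∈ xy′) (child-≢ρ xy′) (trans (sym l) (trans eq l′))
    ... | refl with child-functional xy xy′
    ... | refl = same-edge uv uv′

    -- Since w is outside S, an edge inside S must join ρ to an element of the class of w; the last
    -- hypothesis allots exactly these.
    doubleStarPiece : ∀ {used} (F : V → V → Set) (extras : List V) → length extras ≤ 2 → (∀ {x} → x ∈ₗ extras → x ∉ₗ used) →
      ρ ∈ S ⊎ ρ ∈ₗ extras → w ∈ₗ extras → w ∉ S →
      (∀ {x} → x ∈ S → class ns x ≡ class ns w → ρ ∉ S ⊎ (F x ρ × F ρ x)) →
      Piece (symmetricColouring f f-sym) S used F
    doubleStarPiece F extras few fresh ρ∈ w∈ w∉S inside-S = record
      { tree = doubleStar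
      ; isTree = (connected , ParentForest.acyclic doubleStar Child rank child-functional rank-decreasing edge⇒child) ,
          ∈-comprehension⁺ inTree? ∘ inj₁ , rainbow
      ; extras = extras
      ; few = few
      ; fresh = fresh
      ; covers = cover ∘ ∈-comprehension⁻ inTree?
      ; inner = λ e → inner (edge⇒child e)
      }
      where
      cover : ∀ {x} → InTree x → x ∈ S ⊎ x ∈ₗ extras
      cover (inj₁ x∈S) = inj₁ x∈S
      cover (inj₂ (inj₁ refl)) = ρ∈
      cover (inj₂ (inj₂ refl)) = inj₂ w∈
      inner-child : ∀ {x y} → Child x y → x ∉ S ⊎ y ∉ S ⊎ (F x y × F y x)
      inner-child {x} (hang-ρ _ _ c) with x Subset.∈? S
      ... | no x∉S = inj₁ x∉S
      ... | yes x∈S = inj₂ (inside-S x∈S c)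
      inner-child (hang-w _ _ _) = inj₂ (inj₁ w∉S)
      inner : ∀ {u v} → Adjacent u v → u ∉ S ⊎ v ∉ S ⊎ F u v
      inner (inj₁ uv) with inner-child uv
      ... | inj₁ u∉S = inj₁ u∉S
      ... | inj₂ (inj₁ v∉S) = inj₂ (inj₁ v∉S)
      ... | inj₂ (inj₂ (Fuv , _)) = inj₂ (inj₂ Fuv)
      inner (inj₂ vu) with inner-child vu
      ... | inj₁ v∉S = inj₂ (inj₁ v∉S)
      ... | inj₂ (inj₁ u∉S) = inj₁ u∉S
      ... | inj₂ (inj₂ (_ , Fuv)) = inj₂ (inj₂ Fuv)

-- Rainbow stars and double stars on S

outside-label : ∀ {n} (S : Subset n) → Fin n → Fin (suc ∣ S ∣)
outside-label S x with x Subset.∈? S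
... | yes x∈S = suc (subset-index x∈S)
-- This colour is kept for the edge between the two centres.
... | no _ = zero

outside-label-∉ : ∀ {n} (S : Subset n) {x} → x ∉ S → outside-label S x ≡ zero
outside-label-∉ S {x} x∉S with x Subset.∈? S
... | yes x∈S = contradiction x∈S x∉S
... | no _ = refl

outside-label-injective : ∀ {n} (S : Subset n) {x y} → x ∈ S → outside-label S x ≡ outside-label S y → x ≡ y
outside-label-injective S {x} {y} x∈ eq with x Subset.∈? S | y Subset.∈? S
... | yes x∈S | yes y∈S = subset-index-injective x∈S y∈S (Fin.suc-injective eq)
... | yes _ | no _ = contradiction eq λ ()
... | no x∉S | _ = contradiction x∈ x∉S

inside-label : ∀ {n k} (S : Subset n) → ∣ S ∣ ≡ suc k →
  Σ[ τ ∈ (Fin n → Fin (suc k)) ] (∀ {x y} → x ∈ S → y ∈ S → τ x ≡ τ y → x ≡ y)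
inside-label {k = k} S ∣S∣≡ = τ , τ-injective
  where
  τ : Fin _ → Fin (suc k)
  τ x with x Subset.∈? S
  ... | yes x∈S = Fin.cast ∣S∣≡ (subset-index x∈S)
  ... | no _ = zero
  τ-injective : ∀ {x y} → x ∈ S → y ∈ S → τ x ≡ τ y → x ≡ y
  τ-injective {x} {y} x∈ y∈ eq with x Subset.∈? S | y Subset.∈? S
  ... | yes x∈S | yes y∈S = subset-index-injective x∈S y∈S (Fin.toℕ-injective
    (trans (sym (Fin.toℕ-cast ∣S∣≡ _)) (trans (cong toℕ eq) (Fin.toℕ-cast ∣S∣≡ _))))
  ... | yes _ | no y∉S = contradiction y∈ y∉S
  ... | no x∉S | _ = contradiction x∈ x∉S

∣S∣≡suc⇒nonempty : ∀ {n k} (S : Subset n) → ∣ S ∣ ≡ suc k → ∃[ x ] x ∈ S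
∣S∣≡suc⇒nonempty {n} S ∣S∣≡ with Subset.nonempty? S
... | yes ne = ne
... | no empty = contradiction
  (trans (sym ∣S∣≡) (trans (cong ∣_∣ (Subset.Empty-unique empty)) (Subset.∣⊥∣≡0 n))) λ ()

few-elements⇒missed-class : ∀ {r} (ns : Vec ℕ r) (S : Subset (sum ns)) → ∣ S ∣ < r →
  ∃[ a ] (∀ {x} → x ∈ S → class ns x ≢ a)
few-elements⇒missed-class ns S ∣S∣<r =
  let a , missed = avoid (ℕ.≤-<-trans (length-elements≤ S) ∣S∣<r) (class ns ∘ List.lookup (elements S))
  in a , λ x∈S → subst (λ x → class ns x ≢ a) (sym (lookup-index (∈⇒∈-elements x∈S)))
    (missed (Any.index (∈⇒∈-elements x∈S)))

module UpperBounds {r t-1} (ns : Vec ℕ r) (f : Fin (sum ns) → Fin (sum ns) → Fin (suc t-1))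
  (f-sym : ∀ u v → f u v ≡ f v u) {bound} (extend : Extendable (class ns) f bound) where

  c : EdgeColouring (K ns) (suc t-1)
  c = symmetricColouring f f-sym

  private
    V : Set
    V = Fin (sum ns)

    t : ℕ
    t = suc t-1

  length-++-elements : ∀ used (S : Subset (sum ns)) → length (used ++ elements S) ≤ length used + ∣ S ∣
  length-++-elements used S = subst (_≤ length used + ∣ S ∣) (sym (List.length-++ used))
    (ℕ.+-monoʳ-≤ (length used) (length-elements≤ S))

  module _ (S : Subset (sum ns)) (∣S∣≡t : ∣ S ∣ ≡ t) {used : List V} (room : length used + t ≤ bound) where

    -- The star with centre w is rooted at one of its leaves ρ in S: no element of S shares the
    -- class of w, so all other leaves hang from w.
    missed-class⇒piece : ∀ {a} → (∀ {x} → x ∈ S → class ns x ≢ a) → ∀ F → Piece c S used F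
    missed-class⇒piece {a} missed F =
      let τ , τ-injective = inside-label S ∣S∣≡t
          ρ , ρ∈S = ∣S∣≡suc⇒nonempty S ∣S∣≡t
          w , cw≡a , w∉ , fw = extend (used ++ elements S)
            (ℕ.≤-trans (length-++-elements used S) (subst (λ s → length used + s ≤ bound) (sym ∣S∣≡t) room)) τ a
      in star τ τ-injective ρ ρ∈S w cw≡a (w∉ ∘ ∈-++⁺ˡ) (w∉ ∘ ∈-++⁺ʳ used ∘ ∈⇒∈-elements)
           (fw ∘ ∈-++⁺ʳ used ∘ ∈⇒∈-elements)
      where
      module _ (τ : V → Fin t) (τ-injective : ∀ {x y} → x ∈ S → y ∈ S → τ x ≡ τ y → x ≡ y)
        (ρ : V) (ρ∈S : ρ ∈ S) (w : V) (cw≡a : class ns w ≡ a) (w∉used : w ∉ₗ used) (w∉S : w ∉ S)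
        (fw : ∀ {x} → x ∈ S → f w x ≡ τ x) where

        other-class : ∀ {x} → x ∈ S → class ns x ≢ class ns w
        other-class x∈S cx≡cw = missed x∈S (trans cx≡cw cw≡a)

        open DoubleStar ns f f-sym S ρ w (other-class ρ∈S)

        -- Rooting at the leaf ρ turns the edge between w and ρ into the parent edge of w, so w
        -- inherits the colour meant for ρ.
        label : V → Fin t
        label x = if does (x Fin.≟ w) then τ ρ else τ x

        label-w : label w ≡ τ ρ
        label-w rewrite dec-true (w Fin.≟ w) refl = refl

        label-S : ∀ {x} → x ∈ S → label x ≡ τ x
        label-S {x} x∈S rewrite dec-false (x Fin.≟ w) (λ { refl → w∉S x∈S }) = refl

        label-edge : ∀ {x y} → Child x y → f x y ≡ label x
        label-edge (hang-ρ (inj₁ x∈S) _ c) = contradiction c (other-class x∈S)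
        label-edge (hang-ρ (inj₂ (inj₁ x≡ρ)) x≢ρ _) = contradiction x≡ρ x≢ρ
        label-edge (hang-ρ (inj₂ (inj₂ refl)) _ _) = trans (fw ρ∈S) (sym label-w)
        label-edge (hang-w (inj₁ x∈S) _ _) = trans (f-sym _ _) (trans (fw x∈S) (sym (label-S x∈S)))
        label-edge (hang-w (inj₂ (inj₁ x≡ρ)) x≢ρ _) = contradiction x≡ρ x≢ρ
        label-edge (hang-w (inj₂ (inj₂ refl)) _ ¬c) = contradiction refl ¬c

        label-injective : ∀ {x y} → InTree x → x ≢ ρ → InTree y → y ≢ ρ → label x ≡ label y → x ≡ y
        label-injective (inj₂ (inj₁ x≡ρ)) x≢ρ _ _ _ = contradiction x≡ρ x≢ρ
        label-injective _ _ (inj₂ (inj₁ y≡ρ)) y≢ρ _ = contradiction y≡ρ y≢ρ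
        label-injective (inj₁ x∈S) _ (inj₁ y∈S) _ eq =
          τ-injective x∈S y∈S (trans (sym (label-S x∈S)) (trans eq (label-S y∈S)))
        label-injective (inj₁ x∈S) x≢ρ (inj₂ (inj₂ refl)) _ eq =
          contradiction (τ-injective x∈S ρ∈S (trans (sym (label-S x∈S)) (trans eq label-w))) x≢ρ
        label-injective (inj₂ (inj₂ refl)) _ (inj₁ y∈S) y≢ρ eq =
          contradiction (τ-injective y∈S ρ∈S (trans (sym (label-S y∈S)) (trans (sym eq) label-w))) y≢ρ
        label-injective (inj₂ (inj₂ refl)) _ (inj₂ (inj₂ refl)) _ _ = refl

        star : Piece c S used F
        star = doubleStarPiece label label-edge label-injective F (w ∷ []) (s≤s z≤n)
          (λ { (here refl) → w∉used }) (inj₁ ρ∈S) (here refl) w∉S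
          (λ x∈S cx≡cw → contradiction cx≡cw (other-class x∈S))

  module _ (S : Subset (sum ns)) (∣S∣≡t-1 : ∣ S ∣ ≡ t-1) {used : List V} (room : length used + t ≤ bound) where

    spare-colour⇒piece : ∀ {a b} → b ≢ a → ∀ F → Piece c S used F
    spare-colour⇒piece {a} {b} b≢a F =
      let v , cv≡b , v∉ , fv = extend xs (ℕ.≤-trans (ℕ.n≤1+n _) len) label b
          -- With v on the list the edge between the centres is prescribed too: as v is outside S,
          -- it gets the colour missing on S.
          w , cw≡a , w∉ , fw = extend (v ∷ xs) len label a
      in star v w (λ cv≡cw → b≢a (trans (sym cv≡b) (trans cv≡cw cw≡a)))
           (v∉ ∘ ∈-++⁺ˡ) (v∉ ∘ ∈-++⁺ʳ used ∘ ∈⇒∈-elements) (fv ∘ ∈-++⁺ʳ used ∘ ∈⇒∈-elements)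
           (w∉ ∘ there ∘ ∈-++⁺ˡ) (w∉ ∘ there ∘ ∈-++⁺ʳ used ∘ ∈⇒∈-elements)
           (fw ∘ there ∘ ∈-++⁺ʳ used ∘ ∈⇒∈-elements) (fw (here refl))
      where
      xs : List V
      xs = used ++ elements S
      len : suc (length xs) ≤ bound
      len = begin
        suc (length xs)            ≤⟨ s≤s (length-++-elements used S) ⟩
        suc (length used + ∣ S ∣)  ≡⟨ cong (λ s → suc (length used + s)) ∣S∣≡t-1 ⟩
        suc (length used + t-1)    ≡⟨ ℕ.+-suc (length used) t-1 ⟨
        length used + t            ≤⟨ room ⟩
        bound                      ∎
        where open ℕ.≤-Reasoning
      label : V → Fin t
      label x = Fin.cast (cong suc ∣S∣≡t-1) (outside-label S x)
      label-∉ : ∀ {x} → x ∉ S → label x ≡ zero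
      label-∉ x∉S = cong (Fin.cast (cong suc ∣S∣≡t-1)) (outside-label-∉ S x∉S)
      label-∈-injective : ∀ {x y} → x ∈ S → label x ≡ label y → x ≡ y
      label-∈-injective x∈S eq = outside-label-injective S x∈S (Fin.toℕ-injective
        (trans (sym (Fin.toℕ-cast _ (outside-label S _))) (trans (cong toℕ eq) (Fin.toℕ-cast _ (outside-label S _)))))
      module _ (ρ w : V) (cρ≢cw : class ns ρ ≢ class ns w)
        (ρ∉used : ρ ∉ₗ used) (ρ∉S : ρ ∉ S) (fρ : ∀ {x} → x ∈ S → f ρ x ≡ label x)
        (w∉used : w ∉ₗ used) (w∉S : w ∉ S) (fw : ∀ {x} → x ∈ S → f w x ≡ label x) (fwρ : f w ρ ≡ label ρ) where

        open DoubleStar ns f f-sym S ρ w cρ≢cw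

        label-edge : ∀ {x y} → Child x y → f x y ≡ label x
        label-edge (hang-ρ (inj₁ x∈S) _ _) = trans (f-sym _ _) (fρ x∈S)
        label-edge (hang-ρ (inj₂ (inj₁ x≡ρ)) x≢ρ _) = contradiction x≡ρ x≢ρ
        label-edge (hang-ρ (inj₂ (inj₂ refl)) _ _) = trans fwρ (trans (label-∉ ρ∉S) (sym (label-∉ w∉S)))
        label-edge (hang-w (inj₁ x∈S) _ _) = trans (f-sym _ _) (fw x∈S)
        label-edge (hang-w (inj₂ (inj₁ x≡ρ)) x≢ρ _) = contradiction x≡ρ x≢ρ
        label-edge (hang-w (inj₂ (inj₂ refl)) _ ¬c) = contradiction refl ¬c

        label-injective : ∀ {x y} → InTree x → x ≢ ρ → InTree y → y ≢ ρ → label x ≡ label y → x ≡ y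
        label-injective (inj₂ (inj₁ x≡ρ)) x≢ρ _ _ _ = contradiction x≡ρ x≢ρ
        label-injective _ _ (inj₂ (inj₁ y≡ρ)) y≢ρ _ = contradiction y≡ρ y≢ρ
        label-injective (inj₁ x∈S) _ _ _ eq = label-∈-injective x∈S eq
        label-injective _ _ (inj₁ y∈S) _ eq = sym (label-∈-injective y∈S (sym eq))
        label-injective (inj₂ (inj₂ refl)) _ (inj₂ (inj₂ refl)) _ _ = refl

        star : Piece c S used F
        star = doubleStarPiece label label-edge label-injective F (ρ ∷ w ∷ []) (s≤s (s≤s z≤n))
          (λ { (here refl) → ρ∉used ; (there (here refl)) → w∉used }) (inj₂ (here refl)) (there (here refl)) w∉S
          (λ _ _ → inj₁ ρ∉S)

-- Rainbow paths for k = r = 3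

next : Fin 3 → Fin 3
next zero = suc zero
next (suc zero) = suc (suc zero)
next (suc (suc zero)) = zero

rotate : Fin 3 → Fin 3 → Fin 3
rotate p zero = p
rotate p (suc zero) = next p
rotate p (suc (suc zero)) = next (next p)

rotate-injective : ∀ p e e′ → rotate p e ≡ rotate p e′ → e ≡ e′
rotate-injective = from-yes (Fin.all? λ p → Fin.all? λ e → Fin.all? λ e′ →
  rotate p e Fin.≟ rotate p e′ →-dec e Fin.≟ e′)

next-next≢ : ∀ j → next (next j) ≢ j
next-next≢ j eq with rotate-injective j (suc (suc zero)) zero eq
... | ()

next≢ : ∀ j → next j ≢ j
next≢ j eq with rotate-injective j (suc zero) zero eq
... | ()

third : ∀ j a → a ≢ j → a ≢ next j → a ≡ next (next j)
third = from-yes (Fin.all? λ j → Fin.all? λ a →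
  ¬? (a Fin.≟ j) →-dec ¬? (a Fin.≟ next j) →-dec a Fin.≟ next (next j))

-- S = {s₀ , s₁ , s₂} meets the three classes.  The j-th tree is the path
-- s_j , s_{j+1} , w , s_{j+2} with a new vertex w in the class of s_j.
module Transversal (ns : Vec ℕ 3) (f : Fin (sum ns) → Fin (sum ns) → Fin 3)
  (f-sym : ∀ u v → f u v ≡ f v u) {bound} (extend : Extendable (class ns) f bound)
  (S : Subset (sum ns)) (∣S∣≡3 : ∣ S ∣ ≡ 3) (s : Fin 3 → Fin (sum ns)) (s∈S : ∀ a → s a ∈ S)
  (class-s : ∀ a → class ns (s a) ≡ a) where

  open UpperBounds ns f f-sym extend

  private
    V : Set
    V = Fin (sum ns)

  s-injective : ∀ {a b} → s a ≡ s b → a ≡ b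
  s-injective {a} {b} eq = trans (sym (class-s a)) (trans (cong (class ns) eq) (class-s b))

  s-onto : ∀ {x} → x ∈ S → x ≡ s (class ns x)
  s-onto {x} x∈S = decidable-stable (x Fin.≟ s (class ns x)) λ x≢ → ℕ.<⇒≱ (ℕ.n<1+n 3) (begin
    4                    ≤⟨ unique-⊆⇒length≤ (unique x≢) ⊆S ⟩
    length (elements S)  ≤⟨ length-elements≤ S ⟩
    ∣ S ∣                ≡⟨ ∣S∣≡3 ⟩
    3                    ∎)
    where
    open ℕ.≤-Reasoning
    unique : x ≢ s (class ns x) → Unique (x ∷ List.tabulate s)
    unique x≢ = All.tabulate (λ y∈ x≡y → let a , y≡sa = ∈-tabulate⁻ {f = s} y∈ in
      x≢ (trans x≡y (trans y≡sa (cong s (sym (trans (cong (class ns) (trans x≡y y≡sa)) (class-s a))))))) ∷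
      Unique.tabulate⁺ s-injective
    ⊆S : ∀ {y} → y ∈ₗ x ∷ List.tabulate s → y ∈ₗ elements S
    ⊆S (here refl) = ∈⇒∈-elements x∈S
    ⊆S (there y∈) = let a , y≡sa = ∈-tabulate⁻ {f = s} y∈ in subst (_∈ₗ elements S) (sym y≡sa) (∈⇒∈-elements (s∈S a))

  Side : Fin 3 → V → V → Set
  Side j u v = (u ≡ s j × v ≡ s (next j)) ⊎ (u ≡ s (next j) × v ≡ s j)

  sides-disjoint : ∀ {i j} → i ≢ j → ∀ {u v} → Side i u v → ¬ Side j u v
  sides-disjoint i≢j (inj₁ (u≡ , _)) (inj₁ (u≡′ , _)) = i≢j (s-injective (trans (sym u≡) u≡′))
  sides-disjoint i≢j (inj₂ (_ , v≡)) (inj₂ (_ , v≡′)) = i≢j (s-injective (trans (sym v≡) v≡′))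
  sides-disjoint {i} {j} i≢j (inj₁ (u≡ , v≡)) (inj₂ (u≡′ , v≡′)) =
    -- Opposite orientations of one side would give i = j + 1 and i + 1 = j modulo 3.
    next-next≢ j (trans (cong next (sym (s-injective (trans (sym u≡) u≡′)))) (s-injective (trans (sym v≡) v≡′)))
  sides-disjoint {i} {j} i≢j (inj₂ (u≡ , v≡)) (inj₁ (u≡′ , v≡′)) =
    next-next≢ j (trans (cong next (sym (s-injective (trans (sym v≡) v≡′)))) (s-injective (trans (sym u≡) u≡′)))

  module _ (j : Fin 3) {used : List V} (room : length used + 3 ≤ bound) where

    private
      ρ : V
      ρ = s (next j)

      p : Fin 3
      p = f (s j) ρ

      -- The colour `p` of the side inside S is already fixed, so the two edges at w take the other
      -- two colours. The value at s_j is immaterial: w lies in the same class.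
      τ : V → Fin 3
      τ x = if does (class ns x Fin.≟ next j) then next p else next (next p)

    path-piece : Piece c S used (Side j)
    path-piece =
      let w , cw≡j , w∉ , fw = extend (used ++ elements S)
            (ℕ.≤-trans (length-++-elements used S) (subst (λ s → length used + s ≤ bound) (sym ∣S∣≡3) room)) τ j
      in path w cw≡j (w∉ ∘ ∈-++⁺ˡ) (w∉ ∘ ∈-++⁺ʳ used ∘ ∈⇒∈-elements) (fw ∘ ∈-++⁺ʳ used ∘ ∈⇒∈-elements)
      where
      module _ (w : V) (cw≡j : class ns w ≡ j) (w∉used : w ∉ₗ used) (w∉S : w ∉ S)
        (fw : ∀ {x} → x ∈ S → f w x ≡ τ x) where

        cρ≢cw : class ns ρ ≢ class ns w
        cρ≢cw eq = next≢ j (trans (sym (class-s (next j))) (trans eq cw≡j))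

        open DoubleStar ns f f-sym S ρ w cρ≢cw

        label : V → Fin 3
        label x = if does (x Fin.≟ w) then next p else if does (class ns x Fin.≟ j) then p else next (next p)

        label-w : label w ≡ next p
        label-w rewrite dec-true (w Fin.≟ w) refl = refl

        label-j : ∀ {x} → x ∈ S → class ns x ≡ j → label x ≡ p
        label-j {x} x∈S cx≡j rewrite dec-false (x Fin.≟ w) (λ { refl → w∉S x∈S })
          | dec-true (class ns x Fin.≟ j) cx≡j = refl

        label-third : ∀ {x} → x ∈ S → class ns x ≢ j → label x ≡ next (next p)
        label-third {x} x∈S cx≢j rewrite dec-false (x Fin.≟ w) (λ { refl → w∉S x∈S })
          | dec-false (class ns x Fin.≟ j) cx≢j = refl

        τ-ρ : τ ρ ≡ next p
        τ-ρ rewrite dec-true (class ns ρ Fin.≟ next j) (class-s (next j)) = refl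

        class≢next : ∀ {x} → x ∈ S → x ≢ ρ → class ns x ≢ next j
        class≢next x∈S x≢ρ cx≡ = x≢ρ (trans (s-onto x∈S) (cong s cx≡))

        τ-third : ∀ {x} → x ∈ S → x ≢ ρ → τ x ≡ next (next p)
        τ-third {x} x∈S x≢ρ rewrite dec-false (class ns x Fin.≟ next j) (class≢next x∈S x≢ρ) = refl

        label-edge : ∀ {x y} → Child x y → f x y ≡ label x
        label-edge (hang-ρ (inj₁ x∈S) _ cx≡cw) =
          trans (cong (λ x → f x ρ) (trans (s-onto x∈S) (cong s (trans cx≡cw cw≡j))))
            (sym (label-j x∈S (trans cx≡cw cw≡j)))
        label-edge (hang-ρ (inj₂ (inj₁ x≡ρ)) x≢ρ _) = contradiction x≡ρ x≢ρ
        label-edge (hang-ρ (inj₂ (inj₂ refl)) _ _) = trans (fw (s∈S (next j))) (trans τ-ρ (sym label-w))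
        label-edge (hang-w (inj₁ x∈S) x≢ρ cx≢cw) = trans (f-sym _ _) (trans (fw x∈S) (trans (τ-third x∈S x≢ρ)
          (sym (label-third x∈S λ cx≡j → cx≢cw (trans cx≡j (sym cw≡j))))))
        label-edge (hang-w (inj₂ (inj₁ x≡ρ)) x≢ρ _) = contradiction x≡ρ x≢ρ
        label-edge (hang-w (inj₂ (inj₂ refl)) _ ¬c) = contradiction refl ¬c

        point : Fin 3 → V
        point zero = s j
        point (suc zero) = w
        point (suc (suc zero)) = s (next (next j))

        locate : ∀ {x} → InTree x → x ≢ ρ → ∃[ e ] (x ≡ point e × label x ≡ rotate p e)
        locate (inj₂ (inj₁ x≡ρ)) x≢ρ = contradiction x≡ρ x≢ρ
        locate (inj₂ (inj₂ refl)) _ = suc zero , refl , label-w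
        locate {x} (inj₁ x∈S) x≢ρ = by-class (class ns x Fin.≟ j)
          where
          by-class : Dec (class ns x ≡ j) → ∃[ e ] (x ≡ point e × label x ≡ rotate p e)
          by-class (yes cx≡j) = zero , trans (s-onto x∈S) (cong s cx≡j) , label-j x∈S cx≡j
          by-class (no cx≢j) = suc (suc zero) ,
            trans (s-onto x∈S) (cong s (third j _ cx≢j (class≢next x∈S x≢ρ))) , label-third x∈S cx≢j

        label-injective : ∀ {x y} → InTree x → x ≢ ρ → InTree y → y ≢ ρ → label x ≡ label y → x ≡ y
        label-injective x∈ x≢ρ y∈ y≢ρ eq with locate x∈ x≢ρ | locate y∈ y≢ρ
        ... | e , x≡ , lx | e′ , y≡ , ly = trans x≡ (trans
          (cong point (rotate-injective p e e′ (trans (sym lx) (trans eq ly)))) (sym y≡))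

        path : Piece c S used (Side j)
        path = doubleStarPiece label label-edge label-injective (Side j) (w ∷ []) (s≤s z≤n)
          (λ { (here refl) → w∉used }) (inj₁ (s∈S (next j))) (here refl) w∉S
          λ x∈S cx≡cw → let x≡sj = trans (s-onto x∈S) (cong s (trans cx≡cw cw≡j)) in
            inj₂ (inj₁ (x≡sj , refl) , inj₂ (refl , x≡sj))

-- Rainbow colourability from extendable colourings

k-colourable : ∀ {r k-1 ℓ bound} (ns : Vec ℕ r) (f : Fin (sum ns) → Fin (sum ns) → Fin (suc k-1)) →
  (∀ u v → f u v ≡ f v u) → Extendable (class ns) f bound → ℓ * 2 + suc k-1 ≤ bound →
  suc k-1 < r → RainbowColourable (suc k-1) ℓ (K ns) (suc k-1)
k-colourable {k-1 = k-1} {ℓ} ns f f-sym extend room k<r = c , λ S ∣S∣≡k →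
  let a , missed = few-elements⇒missed-class ns S (subst (_< _) (sym ∣S∣≡k) k<r) in
  pieces⇒trees c S ℓ (λ _ _ _ → ⊥) (λ _ ()) λ _ used len →
    missed-class⇒piece S ∣S∣≡k (ℕ.≤-trans (ℕ.+-monoˡ-≤ (suc k-1) len) room) missed (λ _ _ → ⊥)
  where open UpperBounds ns f f-sym extend

suc-k-colourable : ∀ {r-2 k ℓ bound} (ns : Vec ℕ (suc (suc r-2))) (f : Fin (sum ns) → Fin (sum ns) → Fin (suc k)) →
  (∀ u v → f u v ≡ f v u) → Extendable (class ns) f bound → ℓ * 2 + suc k ≤ bound →
  RainbowColourable k ℓ (K ns) (suc k)
suc-k-colourable {k = k} {ℓ} ns f f-sym extend room = c , λ S ∣S∣≡k →
  pieces⇒trees c S ℓ (λ _ _ _ → ⊥) (λ _ ()) λ _ used len →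
    spare-colour⇒piece S ∣S∣≡k (ℕ.≤-trans (ℕ.+-monoˡ-≤ (suc k) len) room)
      -- The centres go into the first two classes, and no edge inside S is allotted to any tree.
      {zero} {suc zero} (λ ()) (λ _ _ → ⊥)
  where open UpperBounds ns f f-sym extend

3-colourable : ∀ {ℓ bound} (ns : Vec ℕ 3) (f : Fin (sum ns) → Fin (sum ns) → Fin 3) →
  (∀ u v → f u v ≡ f v u) → Extendable (class ns) f bound → ℓ * 2 + 3 ≤ bound →
  ℓ ≤ 3 → RainbowColourable 3 ℓ (K ns) 3
3-colourable {ℓ} {bound} ns f f-sym extend room ℓ≤3 = c , trees
  where
  open UpperBounds ns f f-sym extend
  room′ : ∀ (used : List (Fin (sum ns))) → length used ≤ ℓ * 2 → length used + 3 ≤ bound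
  room′ _ len = ℕ.≤-trans (ℕ.+-monoˡ-≤ 3 len) room
  trees : ∀ S → ∣ S ∣ ≡ 3 → Σ[ T ∈ (Fin ℓ → Subgraph (K ns)) ]
    ((∀ i → IsRainbowSTree c S (T i)) × InternallyDisjoint S T)
  trees S ∣S∣≡3 with Fin.all? (λ a → Fin.any? (λ x → x Subset.∈? S ×-dec class ns x Fin.≟ a))
  -- Each tree consumes one side of the triangle S; the three sides account for ℓ ≤ 3.
  ... | yes s = pieces⇒trees c S ℓ (λ i → Side (side i)) (λ i≢j → sides-disjoint (i≢j ∘ side-injective))
      λ i used len → path-piece (side i) (room′ used len)
    where
    open Transversal ns f f-sym extend S ∣S∣≡3 (proj₁ ∘ s) (proj₁ ∘ proj₂ ∘ s) (proj₂ ∘ proj₂ ∘ s)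
    side : Fin ℓ → Fin 3
    side i = Fin.inject≤ i ℓ≤3
    side-injective : ∀ {i j} → side i ≡ side j → i ≡ j
    side-injective = Fin.inject≤-injective ℓ≤3 ℓ≤3 _ _
  ... | no ¬s with Fin.any? (λ a → ¬? (Fin.any? (λ x → x Subset.∈? S ×-dec class ns x Fin.≟ a)))
  ...   | yes (a , missed) = pieces⇒trees c S ℓ (λ _ _ _ → ⊥) (λ _ ()) λ _ used len →
      missed-class⇒piece S ∣S∣≡3 (room′ used len) (λ x∈S cx≡a → missed (_ , x∈S , cx≡a)) (λ _ _ → ⊥)
  ...   | no none = contradiction (λ a → decidable-stable (Fin.any? (λ x → x Subset.∈? S ×-dec class ns x Fin.≟ a))
      λ ¬x → none (a , ¬x)) ¬s

-- The choice of N

^-distribʳ-* : ∀ m n o → (m * n) ^ o ≡ m ^ o * n ^ o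
^-distribʳ-* m n zero = refl
^-distribʳ-* m n (suc o) rewrite ^-distribʳ-* m n o = ℕ.[m*n]*[o*p]≡[m*o]*[n*p] m n (m ^ o) (n ^ o)

root : ∀ M-1 n → ∃[ b ] (b ^ suc M-1 ≤ n × n < suc b ^ suc M-1)
root M-1 zero = 0 , z≤n , ℕ.m^n>0 1 (suc M-1)
root M-1 (suc n) with root M-1 n
... | b , b^≤n , n<[1+b]^ with suc n <? suc b ^ suc M-1
...   | yes 1+n< = b , ℕ.m≤n⇒m≤1+n b^≤n , 1+n<
...   | no 1+n≮ = suc b , ℕ.≮⇒≥ 1+n≮ ,
  ℕ.≤-<-trans n<[1+b]^ (ℕ.^-monoˡ-< (suc M-1) (ℕ.n<1+n (suc b)))

-- A crude polynomial bound is enough, so the factor a / d is enlarged to a and the exponent u / v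
-- to u.
growth⇒≤ : ∀ m d a n u v .{{_ : NonZero d}} .{{_ : NonZero n}} .{{_ : NonZero v}} →
  (m * d) ^ v ≤ a ^ v * n ^ u → m ≤ a * n ^ u
growth⇒≤ m d a n u v le = ℕ.≮⇒≥ λ an^u<m → ℕ.<-irrefl refl (begin-strict
  (a * n ^ u) ^ v      <⟨ ℕ.^-monoˡ-< v an^u<m ⟩
  m ^ v                ≤⟨ ℕ.^-monoˡ-≤ v (ℕ.m≤m*n m d) ⟩
  (m * d) ^ v          ≤⟨ le ⟩
  a ^ v * n ^ u        ≡⟨ cong (a ^ v *_) (ℕ.^-identityʳ (n ^ u)) ⟨
  a ^ v * (n ^ u) ^ 1  ≤⟨ ℕ.*-monoʳ-≤ (a ^ v) (ℕ.^-monoʳ-≤ (n ^ u) {{ℕ.m^n≢0 n u}} (>-nonZero⁻¹ v)) ⟩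
  a ^ v * (n ^ u) ^ v  ≡⟨ ^-distribʳ-* a (n ^ u) v ⟨
  (a * n ^ u) ^ v      ∎)
  where open ℕ.≤-Reasoning

sum≤ : ∀ {r m} (ns : Vec ℕ r) → (∀ i → lookup ns i ≤ m) → sum ns ≤ r * m
sum≤ [] _ = z≤n
sum≤ (n ∷ ns) le = ℕ.+-mono-≤ (le zero) (sum≤ ns (le ∘ suc))

suc≤^2 : ∀ {b} → 2 ≤ b → suc b ≤ b ^ 2
suc≤^2 {b} 2≤b = begin
  1 + b        ≤⟨ ℕ.+-monoˡ-≤ b (ℕ.<⇒≤ 2≤b) ⟩
  b + b        ≡⟨ cong (b +_) (ℕ.+-identityʳ b) ⟨
  2 * b        ≤⟨ ℕ.*-monoˡ-≤ b 2≤b ⟩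
  b * b        ≡⟨ cong (b *_) (ℕ.*-identityʳ b) ⟨
  b ^ 2        ∎
  where open ℕ.≤-Reasoning

funToFin-cong : ∀ {m n} {f g : Fin m → Fin n} → (∀ i → f i ≡ g i) → Fin.funToFin f ≡ Fin.funToFin g
funToFin-cong {zero} _ = refl
funToFin-cong {suc m} f≗g = cong₂ Fin.combine (f≗g zero) (funToFin-cong (f≗g ∘ suc))

label-count : (L b t K : ℕ) → ℕ
label-count L b t K = suc (K * suc K) * (suc (K * suc K) ^ K * ((L * b) ^ K * t) ^ K)

-- The alphabet enters only through the K letters quoted by each of the K rules; everything else is
-- a constant.
label-count-≡ : ∀ L b t K → label-count L b t K ≡ label-count L 1 t K * b ^ (K * K)
label-count-≡ L b t K = begin
  R * (R ^ K * ((L * b) ^ K * t) ^ K)               ≡⟨ cong (λ x → R * (R ^ K * (x * t) ^ K)) (^-distribʳ-* L b K) ⟩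
  R * (R ^ K * (L ^ K * b ^ K * t) ^ K)             ≡⟨ cong (λ x → R * (R ^ K * x ^ K)) (swap (L ^ K) (b ^ K) t) ⟩
  R * (R ^ K * (L ^ K * t * b ^ K) ^ K)             ≡⟨ cong (λ x → R * (R ^ K * x)) (^-distribʳ-* (L ^ K * t) (b ^ K) K) ⟩
  R * (R ^ K * ((L ^ K * t) ^ K * (b ^ K) ^ K))     ≡⟨ cong₂ (λ x y → R * (R ^ K * ((x ^ K * t) ^ K * y)))
                                                         (sym (ℕ.*-identityʳ L)) (ℕ.^-*-assoc b K K) ⟩
  R * (R ^ K * (((L * 1) ^ K * t) ^ K * b ^ (K * K)))
    ≡⟨ assoc R (R ^ K) (((L * 1) ^ K * t) ^ K) (b ^ (K * K)) ⟩
  R * (R ^ K * ((L * 1) ^ K * t) ^ K) * b ^ (K * K) ∎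
  where
  open ≡-Reasoning
  R : ℕ
  R = suc (K * suc K)
  swap : ∀ x y z → x * y * z ≡ x * z * y
  swap = solve-∀
  assoc : ∀ x y z w → x * (y * (z * w)) ≡ x * (y * z) * w
  assoc = solve-∀

module _ {r} (ns : Vec ℕ (suc r)) (L-1 b t-1 K : ℕ) where

  private
    L n : ℕ
    L = suc L-1
    n = sum ns

  short-names⇒colouring : n ≤ b ^ L → (∀ a → label-count L b (suc t-1) K ≤ lookup ns a) → 1 ≤ lookup ns zero →
    Σ[ f ∈ (Fin n → Fin n → Fin (suc t-1)) ] ((∀ u v → f u v ≡ f v u) × Extendable (class ns) f K)
  short-names⇒colouring n≤ count≤ 1≤n =
    colouring origin label hub , colouring-sym origin label hub , extendable origin label hub
    where
    letter : Fin n → Fin L → Fin b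
    -- The name of v is its expansion in base b with `L` digits.
    letter v = Fin.finToFun (Fin.inject≤ v n≤)

    letter-injective : ∀ {x y} → (∀ p → letter x p ≡ letter y p) → x ≡ y
    letter-injective {x} {y} eq = Fin.inject≤-injective n≤ n≤ x y (trans
      (sym (Fin.funToFin-finToFin {L} {b} (Fin.inject≤ x n≤)))
      (trans (funToFin-cong eq) (Fin.funToFin-finToFin {L} {b} (Fin.inject≤ y n≤))))

    differ : ∀ x y → Σ[ p ∈ Fin L ] (x ≢ y → letter x p ≢ letter y p)
    differ x y with Fin.any? (λ p → ¬? (letter x p Fin.≟ letter y p))
    ... | yes (p , ≢) = p , λ _ → ≢
    ... | no none = zero , λ x≢y → contradiction (letter-injective λ p →
      decidable-stable (letter x p Fin.≟ letter y p) λ ≢ → none (p , ≢)) x≢y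

    open ExtendableColouring (class ns) L b t-1 K letter differ
    size≤ : ∀ a → size enum-label ≤ lookup ns a
    size≤ a = subst (_≤ lookup ns a) (sym size≡) (count≤ a)
      where
      size≡ : size enum-label ≡ label-count L b (suc t-1) K
      size≡ = cong₂ (λ x y → R * (x * y)) (size-enum-vec (enum-fin R) K) (trans
        (size-enum-vec (enum-× (enum-vec (enum-× (enum-fin L) (enum-fin b)) K) (enum-fin (suc t-1))) K)
        (cong (λ x → (x * suc t-1) ^ K) (size-enum-vec (enum-× (enum-fin L) (enum-fin b)) K)))

    origin : Fin n
    origin = vertex ns zero (Fin.fromℕ< 1≤n)

    -- In every class the first positions run through all labels, which is what `hub` demands; later
    -- positions get a default.
    label : Fin n → Label
    label v with position ns v <? size enum-label
    ... | yes p< = decode enum-label (Fin.fromℕ< p<)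
    ... | no _ = default-label origin

    label-decode : ∀ v i → position ns v ≡ toℕ i → label v ≡ decode enum-label i
    label-decode v i eq with position ns v <? size enum-label
    ... | yes p< = cong (decode enum-label) (Fin.toℕ-injective (trans (Fin.toℕ-fromℕ< p<) eq))
    ... | no p≮ = contradiction (subst (_< size enum-label) (sym eq) (Fin.toℕ<n i)) p≮

    hub : ∀ a l → ∃[ w ] (class ns w ≡ a × label w ≡ l)
    hub a l = vertex ns a i , class-vertex ns a i ,
      trans (label-decode (vertex ns a i) (encode enum-label l) (trans (position-vertex ns a i) (Fin.toℕ-inject≤ (encode enum-label l) (size≤ a))))
        (decode-encode enum-label l)
      where
      i : Fin (lookup ns a)
      i = Fin.inject≤ (encode enum-label l) (size≤ a)

first≤ : ∀ {C α N r} {ns : Vec ℕ (suc r)} → Admissible C α N ns → ∀ a → lookup ns zero ≤ lookup ns a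
first≤ adm a = Admissible.monotone adm z≤n

admissible⇒colouring : ∀ C α r t-1 K → ∃[ N ] (∀ {N′} (ns : Vec ℕ (suc r)) → Admissible C α N′ ns → N ≤ N′ →
  Σ[ f ∈ (Fin (sum ns) → Fin (sum ns) → Fin (suc t-1)) ] ((∀ u v → f u v ≡ f v u) × Extendable (class ns) f K))
admissible⇒colouring C α r t-1 K = B ^ M , colour
  where
  cq : ∃[ q ] Upper C q
  cq = ℝ.upper-inhabited C
  αq : ∃[ q ] Upper α q
  αq = ℝ.upper-inhabited α
  A u M L-1 c₀ B : ℕ
  A = ℤ.∣ ℚ.↥ proj₁ cq ∣
  u = ℤ.∣ ℚ.↥ proj₁ αq ∣
  -- One factor b more than in the number of labels absorbs the constant `c₀`.
  M = suc (K * K)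
  -- One letter of the name covers the factor `suc r * A`; replacing b + 1 by b ^ 2 in (b + 1) ^ (M
  -- u) accounts for the others.
  L-1 = 2 * (M * u)
  -- Counting over a one-letter alphabet makes the constant independent of b.
  c₀ = label-count (suc L-1) 1 (suc t-1) K
  -- A sum, so that b ≥ `B` implies all three lower bounds on b at once.
  B = c₀ + suc r * A + 2

  module _ {N′} (ns : Vec ℕ (suc r)) (adm : Admissible C α N′ ns) (N≤N′ : B ^ M ≤ N′) where
    open Admissible adm

    n₁ : ℕ
    n₁ = lookup ns zero

    b : ℕ
    b = proj₁ (root (K * K) n₁)

    b^M≤n₁ : b ^ M ≤ n₁
    b^M≤n₁ = proj₁ (proj₂ (root (K * K) n₁))

    n₁<[1+b]^M : n₁ < suc b ^ M
    n₁<[1+b]^M = proj₂ (proj₂ (root (K * K) n₁))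

    B≤b : B ≤ b
    B≤b = ℕ.≮⇒≥ λ b<B → ℕ.<-irrefl refl (begin-strict
      n₁          <⟨ n₁<[1+b]^M ⟩
      suc b ^ M   ≤⟨ ℕ.^-monoˡ-≤ M b<B ⟩
      B ^ M       ≤⟨ N≤N′ ⟩
      N′          ≤⟨ large ⟩
      n₁          ∎)
      where open ℕ.≤-Reasoning

    c₀≤b : c₀ ≤ b
    c₀≤b = ℕ.≤-trans (ℕ.m≤m+n c₀ _) (ℕ.≤-trans (ℕ.m≤m+n (c₀ + suc r * A) 2) B≤b)

    rA≤b : suc r * A ≤ b
    rA≤b = ℕ.≤-trans (ℕ.m≤n+m (suc r * A) c₀) (ℕ.≤-trans (ℕ.m≤m+n (c₀ + suc r * A) 2) B≤b)

    2≤b : 2 ≤ b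
    2≤b = ℕ.≤-trans (ℕ.m≤n+m 2 (c₀ + suc r * A)) B≤b

    count≤ : ∀ a → label-count (suc L-1) b (suc t-1) K ≤ lookup ns a
    count≤ a = begin
      label-count (suc L-1) b (suc t-1) K  ≡⟨ label-count-≡ (suc L-1) b (suc t-1) K ⟩
      c₀ * b ^ (K * K)                     ≤⟨ ℕ.*-monoˡ-≤ (b ^ (K * K)) c₀≤b ⟩
      b ^ M                                ≤⟨ b^M≤n₁ ⟩
      n₁                                   ≤⟨ first≤ adm a ⟩
      lookup ns a                          ∎
      where open ℕ.≤-Reasoning

    n₁-nonZero : NonZero n₁
    n₁-nonZero = >-nonZero (positive zero)

    last≤ : lookup ns (Fin.fromℕ r) ≤ A * n₁ ^ u
    last≤ = growth⇒≤ (lookup ns (Fin.fromℕ r)) (ℚ.↧ₙ proj₁ cq) A n₁ u (ℚ.↧ₙ proj₁ αq)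
      {{_}} {{n₁-nonZero}} (growth (proj₂ cq) (proj₂ αq))

    sum≤b^L : sum ns ≤ b ^ suc L-1
    sum≤b^L = begin
      sum ns                           ≤⟨ sum≤ ns (λ i → ℕ.≤-trans (monotone (Fin.≤fromℕ i)) last≤) ⟩
      suc r * (A * n₁ ^ u)             ≡⟨ ℕ.*-assoc (suc r) A (n₁ ^ u) ⟨
      suc r * A * n₁ ^ u               ≤⟨ ℕ.*-mono-≤ rA≤b (ℕ.^-monoˡ-≤ u (ℕ.<⇒≤ n₁<[1+b]^M)) ⟩
      b * (suc b ^ M) ^ u              ≡⟨ cong (b *_) (ℕ.^-*-assoc (suc b) M u) ⟩
      b * suc b ^ (M * u)              ≤⟨ ℕ.*-monoʳ-≤ b (ℕ.^-monoˡ-≤ (M * u) (suc≤^2 2≤b)) ⟩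
      b * (b ^ 2) ^ (M * u)            ≡⟨ cong (b *_) (ℕ.^-*-assoc b 2 (M * u)) ⟩
      b ^ suc L-1                      ∎
      where open ℕ.≤-Reasoning

    colour : Σ[ f ∈ (Fin (sum ns) → Fin (sum ns) → Fin (suc t-1)) ]
      ((∀ u v → f u v ≡ f v u) × Extendable (class ns) f K)
    colour = short-names⇒colouring ns L-1 b t-1 K sum≤b^L count≤ (positive zero)

-- The threshold in integer arithmetic

/<⇒< : ∀ m q ℓ .{{_ : NonZero q}} → (ℤ.+ m ℚ./ q) ℚ.< fromℕ ℓ → m < ℓ * q
/<⇒< m (suc q-1) ℓ lt = subst (_< ℓ * suc q-1) (ℕ.*-identityʳ m) (ℤ.drop‿+<+
  (subst₂ ℤ._<_ (sym (ℤ.pos-* m 1)) (sym (ℤ.pos-* ℓ (suc q-1))) (ℚᵘ.drop-*<*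
    (ℚᵘ.<-respˡ-≃ (ℚ.toℚᵘ-fromℚᵘ (ℚᵘ.mkℚᵘ (ℤ.+ m) q-1))
      (ℚᵘ.<-respʳ-≃ (ℚ.toℚᵘ-fromℚᵘ (ℚᵘ.mkℚᵘ (ℤ.+ ℓ) 0)) (ℚ.toℚᵘ-mono-< lt))))))

2*choose2 : ∀ n → 2 * (suc n choose 2) ≡ suc n * n
2*choose2 zero = refl
2*choose2 (suc n) = begin
  2 * (suc (suc n) choose 2)                  ≡⟨ cong (2 *_) (nCk+nC[k+1]≡[n+1]C[k+1] (suc n) 1) ⟨
  2 * (suc n choose 1 + suc n choose 2)       ≡⟨ ℕ.*-distribˡ-+ 2 (suc n choose 1) (suc n choose 2) ⟩
  2 * (suc n choose 1) + 2 * (suc n choose 2) ≡⟨ cong₂ (λ x y → 2 * x + y) (nC1≡n (suc n)) (2*choose2 n) ⟩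
  2 * suc n + suc n * n                       ≡⟨ rearrange n ⟩
  suc (suc n) * suc n                         ∎
  where
  open ≡-Reasoning
  rearrange : ∀ n → 2 * suc n + suc n * n ≡ suc (suc n) * suc n
  rearrange = solve-∀

-- Doubling turns the binomial coefficient into the number of ordered pairs of classes, so that the
-- hypothesis contradicts the bound on darts.
above-threshold : ∀ k ℓ r-1 (r≤k : suc r-1 ≤ k) → threshold k (suc r-1) r≤k ℚ.< fromℕ ℓ →
  suc r-1 * (r-1 * (⌈ k / suc r-1 ⌉ * ⌈ k / suc r-1 ⌉)) < ℓ * (k / suc r-1 * 2)
above-threshold k ℓ r-1 r≤k lt = begin-strict
  r * (r-1 * (Q * Q))            ≡⟨ sym (trans (regroup (r choose 2) Q) (trans (cong (_* (Q * Q)) (2*choose2 r-1)) (ℕ.*-assoc r r-1 (Q * Q)))) ⟩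
  (r choose 2) * Q ^ 2 * 2       <⟨ ℕ.*-monoˡ-< 2 (/<⇒< ((r choose 2) * Q ^ 2) q ℓ {{>-nonZero (m≥n⇒m/n>0 r≤k)}} lt) ⟩
  ℓ * q * 2                      ≡⟨ ℕ.*-assoc ℓ q 2 ⟩
  ℓ * (q * 2)                    ∎
  where
  open ℕ.≤-Reasoning
  r q Q : ℕ
  r = suc r-1
  q = k / r
  Q = ⌈ k / r ⌉
  regroup : ∀ c Q → c * (Q * (Q * 1)) * 2 ≡ 2 * c * (Q * Q)
  regroup = solve-∀

-- Combining the bounds

module _ (C α : ℝ) where

  module _ (k-1 ℓ-1 r-3 : ℕ) (3≤k : 3 ≤ suc k-1) where

    private
      k ℓ r K′ N₁ N₂ N : ℕ
      k = suc k-1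
      ℓ = suc ℓ-1
      r = 3 + r-3
      -- Room for two new vertices per tree, the k elements of S and the first of the two centres.
      K′ = ℓ * 2 + suc k
      N₁ = proj₁ (admissible⇒colouring C α (2 + r-3) k-1 K′)
      N₂ = proj₁ (admissible⇒colouring C α (2 + r-3) k K′)
      -- The summand `k` lets S fit into one class for the lower bounds; `N₁` and `N₂` serve the
      -- colourings with k and k + 1 colours.
      N = k + (N₁ + N₂)

    rainbow-index : ∃[ N ] (1 ≤ N × (∀ (ns : Vec ℕ r) → Admissible C α N ns →
      (k < r → rx k , ℓ ⟨ K ns ⟩≔ k) ×
      ((r≤k : r ≤ k) → fromℕ ℓ ℚ.≤ threshold k r r≤k →
        (rx k , ℓ ⟨ K ns ⟩≔ k) ⊎ (rx k , ℓ ⟨ K ns ⟩≔ suc k)) ×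
      ((r≤k : r ≤ k) → threshold k r r≤k ℚ.< fromℕ ℓ →
        rx k , ℓ ⟨ K ns ⟩≔ suc k)))
    rainbow-index = N , s≤s z≤n , λ ns adm → below ns adm , (λ _ _ → either ns adm) , above ns adm
      where
      module _ (ns : Vec ℕ r) (adm : Admissible C α N ns) where

        k≤size : ∀ a → k ≤ lookup ns a
        k≤size a = ℕ.≤-trans (ℕ.m≤m+n k (N₁ + N₂)) (ℕ.≤-trans (Admissible.large adm) (first≤ adm a))

        at-least-k : ∀ s → RainbowColourable k ℓ (K ns) s → k ≤ s
        at-least-k s = k≤colours ns zero (k≤size zero) (ℕ.<⇒≤ 3≤k) (s≤s z≤n)

        below : k < r → rx k , ℓ ⟨ K ns ⟩≔ k
        below k<r =
          let f , f-sym , extend = proj₂ (admissible⇒colouring C α (2 + r-3) k-1 K′) ns adm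
                (ℕ.≤-trans (ℕ.m≤m+n N₁ N₂) (ℕ.m≤n+m (N₁ + N₂) k))
          in k-colourable ns f f-sym extend (ℕ.+-monoʳ-≤ (ℓ * 2) (ℕ.n≤1+n k)) k<r , at-least-k

        colourable : RainbowColourable k ℓ (K ns) (suc k)
        colourable =
          let f , f-sym , extend = proj₂ (admissible⇒colouring C α (2 + r-3) k K′) ns adm
                (ℕ.≤-trans (ℕ.m≤n+m N₂ N₁) (ℕ.m≤n+m (N₁ + N₂) k))
          in suc-k-colourable ns f f-sym extend ℕ.≤-refl

        either : (rx k , ℓ ⟨ K ns ⟩≔ k) ⊎ (rx k , ℓ ⟨ K ns ⟩≔ suc k)
        either = decide (rainbowColourable? k ℓ k-1)
          where
          decide : Dec (RainbowColourable k ℓ (K ns) k) → (rx k , ℓ ⟨ K ns ⟩≔ k) ⊎ (rx k , ℓ ⟨ K ns ⟩≔ suc k)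
          decide (yes k-suffice) = inj₁ (k-suffice , at-least-k)
          decide (no k-fail) = inj₂ (colourable , λ s s-suffice → ℕ.≤∧≢⇒< (at-least-k s s-suffice)
            λ { refl → k-fail s-suffice })

        above : (r≤k : r ≤ k) → threshold k r r≤k ℚ.< fromℕ ℓ → rx k , ℓ ⟨ K ns ⟩≔ suc k
        above r≤k lt = colourable , λ s s-suffice → ℕ.≰⇒> λ s≤k → ℕ.<⇒≱ (above-threshold k ℓ (2 + r-3) r≤k lt)
          (few-colours⇒ℓ-bound ns (ℕ.<⇒≤ 3≤k) k≤size s≤k s-suffice)

  rainbow-index-3 : ∀ ℓ → 1 ≤ ℓ → ℓ ≤ 3 →
    ∃[ N ] (1 ≤ N × (∀ (ns : Vec ℕ 3) → Admissible C α N ns → rx 3 , ℓ ⟨ K ns ⟩≔ 3))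
  rainbow-index-3 ℓ 1≤ℓ ℓ≤3 = 3 + N , s≤s z≤n , λ ns adm →
    let f , f-sym , extend = proj₂ (admissible⇒colouring C α 2 2 (ℓ * 2 + 3)) ns adm (ℕ.m≤n+m N 3) in
    3-colourable ns f f-sym extend ℕ.≤-refl ℓ≤3 ,
    λ s → k≤colours ns zero (ℕ.≤-trans (ℕ.m≤m+n 3 N) (Admissible.large adm)) (s≤s (s≤s z≤n)) 1≤ℓ
    where
    N : ℕ
    N = proj₁ (admissible⇒colouring C α 2 2 (ℓ * 2 + 3))

theorem3p4 : ∀ (C α : ℝ) → 1ℝ ≤ᴿ α → 0ℝ <ᴿ C →
    (∀ (k ℓ r : ℕ) .{{_ : NonZero r}} → 1 ≤ ℓ → 3 ≤ k → 3 ≤ r →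
    ∃[ N ] (1 ≤ N × (∀ (ns : Vec ℕ r) → Admissible C α N ns →
    (k < r → rx k , ℓ ⟨ K ns ⟩≔ k) ×
    ((r≤k : r ≤ k) → fromℕ ℓ ℚ.≤ threshold k r r≤k →
    (rx k , ℓ ⟨ K ns ⟩≔ k) ⊎ (rx k , ℓ ⟨ K ns ⟩≔ suc k)) ×
    ((r≤k : r ≤ k) → threshold k r r≤k ℚ.< fromℕ ℓ →
    rx k , ℓ ⟨ K ns ⟩≔ suc k))))
    ×
    (∀ (ℓ : ℕ) → 1 ≤ ℓ → ℓ ≤ 3 →
    ∃[ N ] (1 ≤ N × (∀ (ns : Vec ℕ 3) → Admissible C α N ns →
    rx 3 , ℓ ⟨ K ns ⟩≔ 3)))
theorem3p4 C α _ _ =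
  (λ { (suc k-1) (suc ℓ-1) (suc (suc (suc r-3))) _ 3≤k _ → rainbow-index C α k-1 ℓ-1 r-3 3≤k
     ; _ _ 1 _ _ (s≤s ())
     ; _ _ 2 _ _ (s≤s (s≤s ())) }) ,
  rainbow-index-3 C α
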